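{- Let $G=G(V,E)$ be a connected simple graph with $|V|=n$, and let $(O_t)_{t\ge0}$ be the Sliding-$(n+1)$ stochastic process on the acyclic orientations of $G_{\mathbf{r}}$. Let $S_{\mathbf{r}}$ be the set of acyclic orientations of $G_{\mathbf{r}}$ whose unique maximal element is $\mathbf{r}$. Then $\sum_{t\ge1}\mathbb{P}(O_t\in S_{\mathbf{r}})=\infty$, and for every $O\in S_{\mathbf{r}}$, $$\lim_{N\to\infty}\frac{\sum_{t=1}^N\mathbb{P}(O_t=O)}{\sum_{t=1}^N\mathbb{P}(O_t\in S_{\mathbf{r}})}=\frac{e(O|_V)}{n!},$$ where $O|_V$ is the restriction of $O$ to $E$ (an acyclic orientation of $G$). These results hold independently of the initial choice.
   Context: $G_{\mathbf{r}}$ is the graph on $V\sqcup\{\mathbf{r}\}$ obtained from $G$ by adding a vertex $\mathbf{r}$ adjacent to all vertices of $V$. Sliding-$(n+1)$ process: choose an arbitrary bijection $f_0:V\sqcup\{\mathbf{r}\}\to[n+1]$. For $t\ge1$, let $v_{t-1}$ be the vertex with $f_{t-1}(v_{t-1})=n+1$, choose $v_t$ uniformly at random from the neighbors of $v_{t-1}$ in $G_{\mathbf{r}}$, and let $f_t$ be $f_{t-1}$ with the values at $v_{t-1}$ and $v_t$ swapped. $O_t$ is the acyclic orientation of $G_{\mathbf{r}}$ with edge $\{u,v\}$ oriented $(u,v)$ iff $f_t(u)<f_t(v)$. An acyclic orientation is viewed as the poset it generates ($(u,v)$ meaning $u<v$); $e(\cdot)$ denotes the number of linear extensions, i.e. order-preserving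 bijections onto $[n]$. -}

module Defs where

open import Data.Nat as ℕ using (ℕ; zero; suc; _!)
open import Data.Fin using (Fin; zero; suc; toℕ; fromℕ)
open import Data.Bool using (Bool; true; false; _∧_; not; if_then_else_)
open import Data.List using (List; []; _∷_; [_]; concatMap; map; length; allFin)
open import Data.Product using (_×_; Σ)
open import Data.Integer using (+_)
open import Data.Rational as ℚ using (ℚ; 0ℚ; _+_; _*_; _/_; _÷_; ≢-nonZero)
open import Data.Rational.Properties using (_≟_)
open import Relation.Binary.PropositionalEquality using (_≡_)
open import Relation.Nullary using (¬_; yes; no)
open import Relation.Binary.Construct.Closure.Transitive using (TransClosure)
open import Relation.Binary.Construct.Closure.ReflexiveTransitive using (Star)

Adj : ℕ → Set
Adj n = Fin n → Fin n → Bool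

IsSimple : ∀ {n} → Adj n → Set
IsSimple {n} adj = (∀ u v → adj u v ≡ adj v u) × (∀ u → adj u u ≡ false)

Connected : ∀ {n} → Adj n → Set
Connected {n} adj = ∀ (u v : Fin n) → Star (λ a b → adj a b ≡ true) u v

-- G_r : vertex set Fin (suc n); r = zero, vertex v of G is suc v.
𝐫 : ∀ {n} → Fin (suc n)
𝐫 = zero

adjR : ∀ {n} → Adj n → Adj (suc n)
adjR adj zero    zero    = false
adjR adj zero    (suc _) = true
adjR adj (suc _) zero    = true
adjR adj (suc u) (suc v) = adj u v

-- orientations (as Boolean relations; o u v = true means edge oriented (u,v), i.e. u < v)
Orient : ℕ → Set
Orient m = Fin m → Fin m → Bool

IsAcyclicOrientation : ∀ {m} → Adj m → Orient m → Set
IsAcyclicOrientation {m} a o =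
  (∀ u v → o u v ≡ true → a u v ≡ true) ×
  (∀ u v → a u v ≡ true → o u v ≡ not (o v u)) ×
  (∀ u → ¬ TransClosure (λ x y → o x y ≡ true) u u)

IsMaximal : ∀ {m} → Orient m → Fin m → Set
IsMaximal {m} o u = ∀ v → o u v ≡ false

InSr : ∀ {n} → Adj n → Orient (suc n) → Set
InSr {n} adj o = IsAcyclicOrientation (adjR adj) o ×
  (IsMaximal o 𝐫 × (∀ u → IsMaximal o u → u ≡ 𝐫))

-- labelings f : V ⊔ {r} → [n+1], the value n+1 being fromℕ n
Labeling : ℕ → Set
Labeling n = Fin (suc n) → Fin (suc n)

_==ᶠ_ : ∀ {m} → Fin m → Fin m → Bool
zero ==ᶠ zero = true
suc i ==ᶠ suc j = i ==ᶠ j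
_ ==ᶠ _ = false

_<ᵇ_ : ∀ {m} → Fin m → Fin m → Bool
i <ᵇ j = toℕ i ℕ.<ᵇ toℕ j

_==ᵇ_ : Bool → Bool → Bool
true ==ᵇ b = b
false ==ᵇ b = not b

swapAt : ∀ {n} → Labeling n → Fin (suc n) → Fin (suc n) → Labeling n
swapAt f v w x = if x ==ᶠ v then f w else (if x ==ᶠ w then f v else f x)

orientOf : ∀ {n} → Adj n → Labeling n → Orient (suc n)
orientOf adj f u v = adjR adj u v ∧ (f u <ᵇ f v)

neighbours : ∀ {m} → Adj m → Fin m → List (Fin m)
neighbours {m} a v = concatMap (λ w → if a v w then [ w ] else []) (allFin m)

sumℚ : List ℚ → ℚ
sumℚ [] = 0ℚ
sumℚ (x ∷ xs) = x + sumℚ xs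

allᵇ : ∀ {A : Set} → (A → Bool) → List A → Bool
allᵇ p [] = true
allᵇ p (x ∷ xs) = p x ∧ allᵇ p xs

average : List ℚ → ℚ
average [] = 0ℚ
average (x ∷ xs) = sumℚ (x ∷ xs) * ((+ 1) / suc (length xs))

indicator : Bool → ℚ
indicator true = ℚ.1ℚ
indicator false = 0ℚ

-- Prob adj t v f E = P(E(O_t) holds) for the Sliding-(n+1) process started at
-- labeling f whose value n+1 sits at v (computed by conditioning on the first step).
Prob : ∀ {n} → Adj n → ℕ → Fin (suc n) → Labeling n → (Orient (suc n) → Bool) → ℚ
Prob adj zero v f E = indicator (E (orientOf adj f))
Prob adj (suc t) v f E =
  average (map (λ w → Prob adj t w (swapAt f v w) E) (neighbours (adjR adj) v))

PartialSum : ∀ {n} → Adj n → ℕ → Fin (suc n) → Labeling n → (Orient (suc n) → Bool) → ℚ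
PartialSum adj zero v f E = 0ℚ
PartialSum adj (suc N) v f E = PartialSum adj N v f E + Prob adj (suc N) v f E

sameOrient : ∀ {m} → Orient m → Orient m → Bool
sameOrient {m} o o' = allᵇ (λ u → allᵇ (λ v → o u v ==ᵇ o' u v) (allFin m)) (allFin m)

allFuns : ∀ m k → List (Fin m → Fin k)
allFuns zero k = [ (λ ()) ]
allFuns (suc m) k =
  concatMap (λ a → map (λ g → λ { zero → a ; (suc i) → g i }) (allFuns m k)) (allFin k)

-- σ is a linear extension of the poset generated by o: a bijection onto [m]
-- (injective map Fin m → Fin m) preserving every generating relation u < v.
isLinExt : ∀ {m} → Orient m → (Fin m → Fin m) → Bool
isLinExt {m} o σ =
  allᵇ (λ u → allᵇ (λ v →
     (if u ==ᶠ v then true else not (σ u ==ᶠ σ v)) ∧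
     (if o u v then σ u <ᵇ σ v else true)) (allFin m)) (allFin m)

countTrue : ∀ {A : Set} → (A → Bool) → List A → ℕ
countTrue p [] = 0
countTrue p (x ∷ xs) = (if p x then 1 else 0) ℕ.+ countTrue p xs

e : ∀ {m} → Orient m → ℕ
e {m} o = countTrue (isLinExt o) (allFuns m m)

restrictV : ∀ {n} → Orient (suc n) → Orient n
restrictV o u v = o (suc u) (suc v)

_÷ₜ_ : ℚ → ℚ → ℚ
p ÷ₜ q with q ≟ 0ℚ
... | yes _ = 0ℚ
... | no q≢0 = _÷_ p q {{≢-nonZero q≢0}}

{-# OPTIONS --safe #-}

-- The position of the label n+1 moves as a random walk, and going around the triangle 𝐫, u, v
-- exchanges the labels of u and v; as G is connected, all labelings communicate within some D slides.
-- Let S_N(x) be the expected number of visits to O up to time N from the labeling x.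
-- Since S_{N+1} is the mean of S_N over neighbours plus a bounded reward, S_N oscillates over all
-- labelings by at most a constant K that does not depend on N.  Permuting the labels 1, …, n commutes
-- with the process, and a labeling with n+1 at 𝐫 has exactly e(O|_V) of its n! relabelings inducing O.
-- Hence the S_N of the n! relabelings of x sum to e(O|_V) R_N(x), where R_N counts the visits to
-- S_𝐫, so |S_N − (e(O|_V)/n!) R_N| ≤ K.  Finally R_N → ∞, as from any labeling 𝐫 holds n+1 within
-- one step with probability at least 1/(n+1).

module Submission where

open import Algebra.Bundles using (CommutativeMonoid)
open import Algebra.Properties.CommutativeSemigroup using (interchange)
open import Data.Bool using (Bool; true; false; _∧_; not; if_then_else_)
open import Data.Bool.Properties using (T-≡; ∧-zeroʳ; ∧-identityʳ)
open import Data.Fin using (Fin; zero; suc; toℕ; fromℕ; fromℕ<; inject₁; punchOut)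
open import Data.Fin.Permutation.Components using (transpose; transpose-inverse)
import Data.Fin.Properties as Fin
open import Data.Fin.Relation.Unary.Top using (view; ‵fromℕ; ‵inj₁; view-fromℕ; view-inject₁)
open import Data.Integer as ℤ using (+_)
import Data.Integer.Properties as ℤ
open import Data.List using (List; []; _∷_; [_]; _++_; map; length; concatMap; allFin; filterᵇ)
open import Data.List.Membership.Propositional using (_∈_; lose)
open import Data.List.Membership.Propositional.Properties using (∈-allFin)
open import Data.List.Properties using (length-map; length-tabulate; map-tabulate; map-cong)
open import Data.List.Relation.Unary.All as All using (All; []; _∷_)
import Data.List.Relation.Unary.All.Properties as All
open import Data.List.Relation.Unary.Any as Any using (Any; here; there)
open import Data.Nat as ℕ using (ℕ; zero; suc; _≤_; z≤n; s≤s; _!)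
open import Data.Nat.ListAction using (sum)
import Data.Nat.Properties as ℕ
open import Data.Nat.Properties using (_!≢0)
open import Data.Product using (_×_; _,_; proj₁; proj₂; ∃-syntax)
open import Data.Rational as ℚ using (ℚ; 0ℚ; 1ℚ; _+_; _*_; -_; _-_; _<_; _/_; ∣_∣)
import Data.Rational.Properties as ℚ
open import Data.Rational.Solver using (module +-*-Solver)
import Data.Rational.Unnormalised as ℚᵘ
import Data.Rational.Unnormalised.Properties as ℚᵘ
open import Data.Sum using (inj₁; inj₂)
import Data.Vec.Functional as F
open import Function using (_∘_; id)
open import Function.Bundles using (Equivalence)
open import Function.Definitions using (Injective)
open import Relation.Binary.Construct.Closure.ReflexiveTransitive as Path using (Star; _◅_)
open import Relation.Binary.Construct.Closure.Transitive as Plus using (TransClosure; _∷_)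
open import Relation.Binary.PropositionalEquality hiding ([_])
open import Relation.Nullary using (¬_; Dec; does; yes; no; isYes; contradiction)
open import Relation.Nullary.Decidable using (dec-true; dec-false)

open import Defs
open +-*-Solver

-- Every slide composes the labeling with a transposition, so the chain on labelings alternates
-- between even and odd ones and has period 2. The probabilities at time t need not converge: for n
-- = 1 the event O_t ∈ S_𝐫 is alternately certain and impossible. Hence communication is measured by
-- "at most D slides", and only partial sums are compared; no stationary distribution or ergodic
-- theorem enters. The bounded oscillation comes from a potential: a state gets a better bound the
-- fewer slides separate it from the target. The potential grows geometrically, because only one of
-- up to n+1 neighbours is known to be closer and its advantage is diluted by the mean. Labelings
-- and orientations are functions and function extensionality is not assumed, so states are compared
-- pointwise and events must respect pointwise equality. Membership in S_𝐫 comes with an arbitrary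
-- decision procedure; on the states of the process it is replaced by the test whether n+1 sits at
-- 𝐫.

-- Natural numbers inside the rationals

ι : ℕ → ℚ
ι m = + m / 1

toℚᵘ-/ : ∀ i d → ℚ.toℚᵘ (i / suc d) ℚᵘ.≃ ℚᵘ.mkℚᵘ i d
toℚᵘ-/ i d = ℚ.toℚᵘ-fromℚᵘ (ℚᵘ.mkℚᵘ i d)

ι-suc : ∀ m → ι (suc m) ≡ 1ℚ + ι m
ι-suc m = ℚ.toℚᵘ-injective (begin-equality
  ℚ.toℚᵘ (ι (suc m))               ≃⟨ toℚᵘ-/ (+ suc m) 0 ⟩
  ℚᵘ.mkℚᵘ (+ suc m) 0              ≃⟨ ℚᵘ.*≡* (cong (λ k → (+ 1 ℤ.+ k) ℤ.* + 1) (sym (ℤ.*-identityʳ (+ m)))) ⟩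
  ℚᵘ.1ℚᵘ ℚᵘ.+ ℚᵘ.mkℚᵘ (+ m) 0      ≃⟨ ℚᵘ.+-congʳ ℚᵘ.1ℚᵘ (ℚᵘ.≃-sym (toℚᵘ-/ (+ m) 0)) ⟩
  ℚ.toℚᵘ 1ℚ ℚᵘ.+ ℚ.toℚᵘ (ι m)      ≃⟨ ℚᵘ.≃-sym (ℚ.toℚᵘ-homo-+ 1ℚ (ι m)) ⟩
  ℚ.toℚᵘ (1ℚ + ι m)                ∎)
  where open ℚᵘ.≤-Reasoning

ι-*-/ : ∀ m n .{{_ : ℕ.NonZero n}} → ι n * (+ m / n) ≡ ι m
ι-*-/ m n@(suc d) = ℚ.toℚᵘ-injective (begin-equality
  ℚ.toℚᵘ (ι n * (+ m / n))             ≃⟨ ℚ.toℚᵘ-homo-* (ι n) (+ m / n) ⟩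
  ℚ.toℚᵘ (ι n) ℚᵘ.* ℚ.toℚᵘ (+ m / n)   ≃⟨ ℚᵘ.*-cong (toℚᵘ-/ (+ n) 0) (toℚᵘ-/ (+ m) d) ⟩
  ℚᵘ.mkℚᵘ (+ n) 0 ℚᵘ.* ℚᵘ.mkℚᵘ (+ m) d ≃⟨ ℚᵘ.*≡* (trans (ℤ.*-identityʳ _)
    (trans (ℤ.*-comm (+ n) (+ m)) (cong (λ k → + m ℤ.* + suc k) (sym (ℕ.+-identityʳ d))))) ⟩
  ℚᵘ.mkℚᵘ (+ m) 0                      ≃⟨ ℚᵘ.≃-sym (toℚᵘ-/ (+ m) 0) ⟩
  ℚ.toℚᵘ (ι m)                         ∎)
  where open ℚᵘ.≤-Reasoning

ι-nonNeg : ∀ m → ℚ.NonNegative (ι m)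
ι-nonNeg m = ℚ.normalize-nonNeg m 1

0≤1 : 0ℚ ℚ.≤ 1ℚ
0≤1 = ℚ.nonNegative⁻¹ 1ℚ

0≤ι : ∀ m → 0ℚ ℚ.≤ ι m
0≤ι m = ℚ.nonNegative⁻¹ (ι m) {{ι-nonNeg m}}

p≤p+q : ∀ p {q} → 0ℚ ℚ.≤ q → p ℚ.≤ p + q
p≤p+q p {q} 0≤q = subst (ℚ._≤ p + q) (ℚ.+-identityʳ p) (ℚ.+-monoʳ-≤ p 0≤q)

p≤q+p : ∀ p {q} → 0ℚ ℚ.≤ q → p ℚ.≤ q + p
p≤q+p p {q} 0≤q = subst (ℚ._≤ q + p) (ℚ.+-identityˡ p) (ℚ.+-monoˡ-≤ p 0≤q)

0≤+ : ∀ {p q} → 0ℚ ℚ.≤ p → 0ℚ ℚ.≤ q → 0ℚ ℚ.≤ p + q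
0≤+ 0≤p 0≤q = ℚ.+-mono-≤ 0≤p 0≤q

0≤* : ∀ {p q} → 0ℚ ℚ.≤ p → 0ℚ ℚ.≤ q → 0ℚ ℚ.≤ p * q
0≤* {p} {q} 0≤p 0≤q = ℚ.nonNegative⁻¹ (p * q)
  {{ℚ.nonNeg*nonNeg⇒nonNeg p {{ℚ.nonNegative 0≤p}} q {{ℚ.nonNegative 0≤q}}}}

ι-mono : ∀ {l m} → l ≤ m → ι l ℚ.≤ ι m
ι-mono {m = m} z≤n = 0≤ι m
ι-mono {suc l} {suc m} (s≤s l≤m) =
  subst₂ ℚ._≤_ (sym (ι-suc l)) (sym (ι-suc m)) (ℚ.+-monoʳ-≤ 1ℚ (ι-mono l≤m))

∣∣-≤ : ∀ {p b} → p ℚ.≤ b → - p ℚ.≤ b → ∣ p ∣ ℚ.≤ b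
∣∣-≤ {p} p≤b -p≤b with ℚ.∣p∣≡p∨∣p∣≡-p p
... | inj₁ eq = subst (ℚ._≤ _) (sym eq) p≤b
... | inj₂ eq = subst (ℚ._≤ _) (sym eq) -p≤b

archimedean : ∀ p → ∃[ m ] p < ι m
archimedean p = suc ℤ.∣ ℚ.↥ p ∣ ,
  ℚ.toℚᵘ-cancel-< (ℚᵘ.<-respʳ-≃ (ℚᵘ.≃-sym (toℚᵘ-/ (+ suc ℤ.∣ ℚ.↥ p ∣) 0)) (bound p))
  where
  bound : ∀ p → ℚ.toℚᵘ p ℚᵘ.< ℚᵘ.mkℚᵘ (+ suc ℤ.∣ ℚ.↥ p ∣) 0
  bound (ℚ.mkℚ ℤ.-[1+ a ] d _) = ℚᵘ.*<* ℤ.-<+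
  bound (ℚ.mkℚ (+ a) d _)      = ℚᵘ.*<* (subst₂ ℤ._<_ (sym (ℤ.*-identityʳ (+ a)))
    (ℤ.pos-* (suc a) (suc d)) (ℤ.+<+ (ℕ.m≤m*n (suc a) (suc d))))

-- Finite sums and averages of rationals

sumℚ-map-+ : ∀ {A : Set} (f g : A → ℚ) xs →
  sumℚ (map (λ x → f x + g x) xs) ≡ sumℚ (map f xs) + sumℚ (map g xs)
sumℚ-map-+ f g []       = refl
sumℚ-map-+ f g (x ∷ xs) = trans (cong (λ s → f x + g x + s) (sumℚ-map-+ f g xs))
  (interchange (CommutativeMonoid.commutativeSemigroup ℚ.+-0-commutativeMonoid)
    (f x) (g x) (sumℚ (map f xs)) (sumℚ (map g xs)))

sumℚ-map-* : ∀ {A : Set} c (f : A → ℚ) xs →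
  sumℚ (map (λ x → c * f x) xs) ≡ c * sumℚ (map f xs)
sumℚ-map-* c f []       = sym (ℚ.*-zeroʳ c)
sumℚ-map-* c f (x ∷ xs) = trans (cong (λ s → c * f x + s) (sumℚ-map-* c f xs))
  (sym (ℚ.*-distribˡ-+ c (f x) _))

sumℚ-map-0 : ∀ {A : Set} (xs : List A) → sumℚ (map (λ _ → 0ℚ) xs) ≡ 0ℚ
sumℚ-map-0 []       = refl
sumℚ-map-0 (x ∷ xs) = trans (ℚ.+-identityˡ _) (sumℚ-map-0 xs)

sumℚ-map-cong : ∀ {A : Set} {f g : A → ℚ} {xs} →
  All (λ x → f x ≡ g x) xs → sumℚ (map f xs) ≡ sumℚ (map g xs)
sumℚ-map-cong []         = refl
sumℚ-map-cong (eq ∷ eqs) = cong₂ _+_ eq (sumℚ-map-cong eqs)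

sumℚ-swap : ∀ {A B : Set} (F : A → B → ℚ) xs ys →
  sumℚ (map (λ x → sumℚ (map (F x) ys)) xs) ≡ sumℚ (map (λ y → sumℚ (map (λ x → F x y) xs)) ys)
sumℚ-swap F []       ys = sym (sumℚ-map-0 ys)
sumℚ-swap F (x ∷ xs) ys = trans (cong (λ s → sumℚ (map (F x) ys) + s) (sumℚ-swap F xs ys))
  (sym (sumℚ-map-+ (F x) (λ y → sumℚ (map (λ x → F x y) xs)) ys))

sumℚ-lower : ∀ {A : Set} {a} (f : A → ℚ) {xs} →
  All (λ x → a ℚ.≤ f x) xs → ι (length xs) * a ℚ.≤ sumℚ (map f xs)
sumℚ-lower {a = a} f []                  = ℚ.≤-reflexive (ℚ.*-zeroˡ a)
sumℚ-lower {a = a} f (_∷_ {xs = xs} p ps) = subst (ℚ._≤ _)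
  (sym (trans (cong (_* a) (ι-suc (length xs)))
    (solve 2 (λ l a → (con 1ℚ :+ l) :* a := a :+ l :* a) refl (ι (length xs)) a)))
  (ℚ.+-mono-≤ p (sumℚ-lower f ps))

sumℚ-upper : ∀ {A : Set} {a} (f : A → ℚ) {xs} →
  All (λ x → f x ℚ.≤ a) xs → sumℚ (map f xs) ℚ.≤ ι (length xs) * a
sumℚ-upper {a = a} f []                  = ℚ.≤-reflexive (sym (ℚ.*-zeroˡ a))
sumℚ-upper {a = a} f (_∷_ {x} {xs} p ps) = subst (f x + sumℚ (map f xs) ℚ.≤_)
  (sym (trans (cong (_* a) (ι-suc (length xs)))
    (solve 2 (λ l a → (con 1ℚ :+ l) :* a := a :+ l :* a) refl (ι (length xs)) a)))
  (ℚ.+-mono-≤ p (sumℚ-upper f ps))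

sumℚ-lower⁺ : ∀ {A : Set} {a g} (f : A → ℚ) {xs} → All (λ x → a ℚ.≤ f x) xs →
  Any (λ x → a + g ℚ.≤ f x) xs → ι (length xs) * a + g ℚ.≤ sumℚ (map f xs)
sumℚ-lower⁺ {a = a} {g} f (_∷_ {xs = xs} p ps) (here q) = subst (ℚ._≤ _)
  (sym (trans (cong (λ l → l * a + g) (ι-suc (length xs)))
    (solve 3 (λ l a g → (con 1ℚ :+ l) :* a :+ g := (a :+ g) :+ l :* a) refl (ι (length xs)) a g)))
  (ℚ.+-mono-≤ q (sumℚ-lower f ps))
sumℚ-lower⁺ {a = a} {g} f (_∷_ {xs = xs} p ps) (there q) = subst (ℚ._≤ _)
  (sym (trans (cong (λ l → l * a + g) (ι-suc (length xs)))
    (solve 3 (λ l a g → (con 1ℚ :+ l) :* a :+ g := a :+ (l :* a :+ g)) refl (ι (length xs)) a g)))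
  (ℚ.+-mono-≤ p (sumℚ-lower⁺ f ps q))

-- The factor is chosen before `f`, so every linear law of `sumℚ` passes to `average` with one
-- common factor. The empty list is covered too, by the factor 0.
average-scale : ∀ {A : Set} (xs : List A) → ∃[ s ] (∀ f → average (map f xs) ≡ s * sumℚ (map f xs))
average-scale []       = 0ℚ , λ f → refl
average-scale (x ∷ xs) = + 1 / suc (length xs) , λ f →
  trans (ℚ.*-comm _ (+ 1 / suc (length (map f xs))))
    (cong (λ l → + 1 / suc l * sumℚ (map f (x ∷ xs))) (length-map f xs))

average-map-+ : ∀ {A : Set} (f g : A → ℚ) xs →
  average (map (λ x → f x + g x) xs) ≡ average (map f xs) + average (map g xs)
average-map-+ f g xs with s , eq ← average-scale xs
  rewrite eq (λ x → f x + g x) | eq f | eq g | sumℚ-map-+ f g xs = ℚ.*-distribˡ-+ s _ _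

average-map-* : ∀ {A : Set} c (f : A → ℚ) xs →
  average (map (λ x → c * f x) xs) ≡ c * average (map f xs)
average-map-* c f xs with s , eq ← average-scale xs
  rewrite eq (λ x → c * f x) | eq f | sumℚ-map-* c f xs =
    solve 3 (λ s c m → s :* (c :* m) := c :* (s :* m)) refl s c (sumℚ (map f xs))

average-map-cong : ∀ {A : Set} {f g : A → ℚ} {xs} →
  All (λ x → f x ≡ g x) xs → average (map f xs) ≡ average (map g xs)
average-map-cong {f = f} {g} {xs} eqs with s , eq ← average-scale xs
  rewrite eq f | eq g = cong (s *_) (sumℚ-map-cong eqs)

average-sum : ∀ {A B : Set} (F : A → B → ℚ) xs ys →
  sumℚ (map (λ x → average (map (F x) ys)) xs) ≡ average (map (λ y → sumℚ (map (λ x → F x y) xs)) ys)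
average-sum F xs ys with s , eq ← average-scale ys
  rewrite eq (λ y → sumℚ (map (λ x → F x y) xs)) | sym (sumℚ-swap F xs ys)
  = trans (sumℚ-map-cong {xs = xs} (All.tabulate (λ {x} _ → eq (F x)))) (sumℚ-map-* s _ xs)

indicator-nonNeg : ∀ b → 0ℚ ℚ.≤ indicator b
indicator-nonNeg true  = 0≤1
indicator-nonNeg false = ℚ.≤-refl

indicator≤1 : ∀ b → indicator b ℚ.≤ 1ℚ
indicator≤1 true  = ℚ.≤-refl
indicator≤1 false = 0≤1

sumℚ-nonNeg : ∀ {xs} → All (0ℚ ℚ.≤_) xs → 0ℚ ℚ.≤ sumℚ xs
sumℚ-nonNeg []       = ℚ.≤-refl
sumℚ-nonNeg (p ∷ ps) = 0≤+ p (sumℚ-nonNeg ps)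

average-nonNeg : ∀ {xs} → All (0ℚ ℚ.≤_) xs → 0ℚ ℚ.≤ average xs
average-nonNeg []                   = ℚ.≤-refl
average-nonNeg (_∷_ {xs = xs} p ps) = 0≤* (0≤+ p (sumℚ-nonNeg ps))
  (ℚ.nonNegative⁻¹ (+ 1 / suc (length xs)) {{ℚ.normalize-nonNeg 1 (suc (length xs))}})

-- A surplus of d·g in one entry is divided by a length of at most d, so at least g of it survives.
-- The `Any` argument also excludes the empty list, whose average is 0 by convention.
average-lower : ∀ {A : Set} {a g} {d} (f : A → ℚ) {xs} → length xs ≤ d → 0ℚ ℚ.≤ g →
  All (λ x → a ℚ.≤ f x) xs → Any (λ x → a + ι d * g ℚ.≤ f x) xs → a + g ℚ.≤ average (map f xs)
average-lower {a = a} {g} {d} f {x ∷ xs} len≤d 0≤g ps q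
  rewrite length-map f xs = subst (ℚ._≤ _) cancel
    (ℚ.*-monoʳ-≤-nonNeg (+ 1 / suc (length xs)) {{ℚ.normalize-nonNeg 1 (suc (length xs))}} bound)
  where
  l = ι (suc (length xs))
  bound : l * (a + g) ℚ.≤ sumℚ (map f (x ∷ xs))
  bound = ℚ.≤-trans
    (subst (ℚ._≤ l * a + ι d * g) (sym (ℚ.*-distribˡ-+ l a g))
      (ℚ.+-monoʳ-≤ (l * a) (ℚ.*-monoʳ-≤-nonNeg g {{ℚ.nonNegative 0≤g}} (ι-mono len≤d))))
    (sumℚ-lower⁺ f ps q)
  cancel : l * (a + g) * (+ 1 / suc (length xs)) ≡ a + g
  cancel = trans (solve 3 (λ l b s → l :* b :* s := l :* s :* b) refl l (a + g) (+ 1 / suc (length xs)))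
    (trans (cong (_* (a + g)) (ι-*-/ 1 (suc (length xs)))) (ℚ.*-identityˡ (a + g)))

+≤⇒-+≤ : ∀ a x y → x + y ℚ.≤ a → - a + y ℚ.≤ - 1ℚ * x
+≤⇒-+≤ a x y le = subst₂ ℚ._≤_
  (solve 3 (λ a x y → x :+ y :+ (:- a :- x) := :- a :+ y) refl a x y)
  (solve 2 (λ a x → a :+ (:- a :- x) := :- con 1ℚ :* x) refl a x)
  (ℚ.+-monoˡ-≤ (- a - x) le)

-+≤⇒+≤ : ∀ a x y → - a + y ℚ.≤ - 1ℚ * x → x + y ℚ.≤ a
-+≤⇒+≤ a x y le = subst₂ ℚ._≤_
  (solve 3 (λ a x y → :- a :+ y :+ (a :+ x) := x :+ y) refl a x y)
  (solve 2 (λ a x → :- con 1ℚ :* x :+ (a :+ x) := a) refl a x)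
  (ℚ.+-monoˡ-≤ (a + x) le)

-- This is `average-lower` for the negated function; the two preceding lemmas move the terms across
-- the sign change.
average-upper : ∀ {A : Set} {a g} {d} (f : A → ℚ) {xs} → length xs ≤ d → 0ℚ ℚ.≤ g →
  All (λ x → f x ℚ.≤ a) xs → Any (λ x → f x + ι d * g ℚ.≤ a) xs → average (map f xs) + g ℚ.≤ a
average-upper {a = a} {g} {d} f {xs} len≤d 0≤g ps q =
  -+≤⇒+≤ a (average (map f xs)) g (subst (- a + g ℚ.≤_) (average-map-* (- 1ℚ) f xs)
    (average-lower (λ x → - 1ℚ * f x) len≤d 0≤g
      (All.map (λ {x} p → subst (ℚ._≤ - 1ℚ * f x) (ℚ.+-identityʳ (- a))
        (+≤⇒-+≤ a (f x) 0ℚ (subst (ℚ._≤ a) (sym (ℚ.+-identityʳ (f x))) p))) ps)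
      (Any.map (λ {x} → +≤⇒-+≤ a (f x) (ι d * g)) q)))

-- Slides as transpositions of positions

==ᶠ-refl : ∀ {m} (i : Fin m) → (i ==ᶠ i) ≡ true
==ᶠ-refl zero    = refl
==ᶠ-refl (suc i) = ==ᶠ-refl i

==ᶠ⇒≡ : ∀ {m} (i j : Fin m) → (i ==ᶠ j) ≡ true → i ≡ j
==ᶠ⇒≡ zero    zero    _  = refl
==ᶠ⇒≡ (suc i) (suc j) eq = cong suc (==ᶠ⇒≡ i j eq)

≢⇒==ᶠ : ∀ {m} {i j : Fin m} → i ≢ j → (i ==ᶠ j) ≡ false
≢⇒==ᶠ {i = i} {j} i≢j with i ==ᶠ j in eq
... | false = refl
... | true  = contradiction (==ᶠ⇒≡ i j eq) i≢j

==ᶠ-does : ∀ {m} (i j : Fin m) → (i ==ᶠ j) ≡ does (i Fin.≟ j)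
==ᶠ-does zero    zero    = refl
==ᶠ-does zero    (suc j) = refl
==ᶠ-does (suc i) zero    = refl
==ᶠ-does (suc i) (suc j) = ==ᶠ-does i j

-- Turns a slide into precomposition with a transposition, so that sequences of slides can be
-- computed as products of transpositions, the latest slide acting first on the position.
swapAt-transpose : ∀ {n} (f : Labeling n) v w x → swapAt f v w x ≡ f (transpose v w x)
swapAt-transpose f v w x rewrite ==ᶠ-does x v | ==ᶠ-does x w with does (x Fin.≟ v)
... | true  = refl
... | false with does (x Fin.≟ w)
...   | true  = refl
...   | false = refl

module _ {m : ℕ} where

  transpose-left : (v w : Fin m) → transpose v w v ≡ w
  transpose-left v w rewrite dec-true (v Fin.≟ v) refl = refl

  transpose-right : (v w : Fin m) → transpose v w w ≡ v
  transpose-right v w with w Fin.≟ v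
  ... | yes w≡v = w≡v
  ... | no _ rewrite dec-true (w Fin.≟ w) refl = refl

  transpose-other : (v w x : Fin m) → x ≢ v → x ≢ w → transpose v w x ≡ x
  transpose-other v w x x≢v x≢w rewrite dec-false (x Fin.≟ v) x≢v | dec-false (x Fin.≟ w) x≢w = refl

  transpose-injective : (v w : Fin m) → Injective _≡_ _≡_ (transpose v w)
  transpose-injective v w eq = trans (sym (transpose-inverse w v))
    (trans (cong (transpose w v) eq) (transpose-inverse w v))

  transpose-refl : (v x : Fin m) → transpose v v x ≡ x
  transpose-refl v x = go x (x Fin.≟ v)
    where
    go : ∀ x → Dec (x ≡ v) → transpose v v x ≡ x
    go _ (yes refl) = transpose-left v v
    go x (no x≢v)   = transpose-other v v x x≢v x≢v

  private
    compose : (f g h : Fin m → Fin m) → ∀ x y z {w} → h x ≡ y → g y ≡ z → f z ≡ w → f (g (h x)) ≡ w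
    compose f g h _ _ _ refl refl refl = refl

  -- In cycle notation (a b)(b c)(c a) = (b c). With a = 𝐫 the left side is a tour of the label n+1
  -- around a triangle.
  transpose-triangle : {a b c : Fin m} → a ≢ b → b ≢ c → a ≢ c → ∀ x →
    transpose a b (transpose b c (transpose c a x)) ≡ transpose b c x
  transpose-triangle {a} {b} {c} a≢b b≢c a≢c x = go x (x Fin.≟ a) (x Fin.≟ b) (x Fin.≟ c)
    where
    product = compose (transpose a b) (transpose b c) (transpose c a)
    go : ∀ x → Dec (x ≡ a) → Dec (x ≡ b) → Dec (x ≡ c) →
      transpose a b (transpose b c (transpose c a x)) ≡ transpose b c x
    go _ (yes refl) _ _ = trans (product a c b (transpose-right c a) (transpose-right b c) (transpose-right a b))
      (sym (transpose-other b c a a≢b a≢c))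
    go _ (no b≢a) (yes refl) _ =
      trans (product b b c (transpose-other c a b b≢c b≢a) (transpose-left b c)
        (transpose-other a b c (a≢c ∘ sym) (b≢c ∘ sym)))
        (sym (transpose-left b c))
    go _ (no _) (no _) (yes refl) =
      trans (product c a a (transpose-left c a) (transpose-other b c a a≢b a≢c) (transpose-left a b))
        (sym (transpose-right b c))
    go x (no x≢a) (no x≢b) (no x≢c) =
      trans (product x x x (transpose-other c a x x≢c x≢a) (transpose-other b c x x≢b x≢c)
        (transpose-other a b x x≢a x≢b))
        (sym (transpose-other b c x x≢b x≢c))

  -- Conjugation (a b)(b c)(a b) = (a c), which carries swaps from edges to paths.
  transpose-conjugate : {a b c : Fin m} → a ≢ b → b ≢ c → a ≢ c → ∀ x →
    transpose a b (transpose b c (transpose a b x)) ≡ transpose a c x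
  transpose-conjugate {a} {b} {c} a≢b b≢c a≢c x = go x (x Fin.≟ a) (x Fin.≟ b) (x Fin.≟ c)
    where
    product = compose (transpose a b) (transpose b c) (transpose a b)
    go : ∀ x → Dec (x ≡ a) → Dec (x ≡ b) → Dec (x ≡ c) →
      transpose a b (transpose b c (transpose a b x)) ≡ transpose a c x
    go _ (yes refl) _ _ =
      trans (product a b c (transpose-left a b) (transpose-left b c)
        (transpose-other a b c (a≢c ∘ sym) (b≢c ∘ sym)))
        (sym (transpose-left a c))
    go _ (no b≢a) (yes refl) _ =
      trans (product b a a (transpose-right a b) (transpose-other b c a a≢b a≢c) (transpose-left a b))
        (sym (transpose-other a c b b≢a b≢c))
    go _ (no c≢a) (no c≢b) (yes refl) =
      trans (product c c b (transpose-other a b c c≢a c≢b) (transpose-right b c) (transpose-right a b))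
        (sym (transpose-right a c))
    go x (no x≢a) (no x≢b) (no x≢c) =
      trans (product x x x (transpose-other a b x x≢a x≢b) (transpose-other b c x x≢b x≢c)
        (transpose-other a b x x≢a x≢b))
        (sym (transpose-other a c x x≢a x≢c))

swapAt³-transpose : ∀ {n} (f : Labeling n) a b c d p q x →
  swapAt (swapAt (swapAt f a b) c d) p q x ≡ f (transpose a b (transpose c d (transpose p q x)))
swapAt³-transpose f a b c d p q x =
  trans (swapAt-transpose (swapAt (swapAt f a b) c d) p q x)
    (trans (swapAt-transpose (swapAt f a b) c d (transpose p q x))
      (swapAt-transpose f a b (transpose c d (transpose p q x))))

swapAt-cong : ∀ {n} {f g : Labeling n} → f ≗ g → ∀ v w → swapAt f v w ≗ swapAt g v w
swapAt-cong {f = f} {g} f≗g v w x = trans (swapAt-transpose f v w x)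
  (trans (f≗g _) (sym (swapAt-transpose g v w x)))

swapAt-injective : ∀ {n} {f : Labeling n} → Injective _≡_ _≡_ f → ∀ v w → Injective _≡_ _≡_ (swapAt f v w)
swapAt-injective {f = f} inj v w {x} {y} eq = transpose-injective v w
  (inj (trans (sym (swapAt-transpose f v w x)) (trans eq (swapAt-transpose f v w y))))

injective⇒surjective : ∀ {m} {f : Fin m → Fin m} → Injective _≡_ _≡_ f → ∀ y → ∃[ x ] f x ≡ y
injective⇒surjective {m} {f} inj y with Fin.any? (λ x → f x Fin.≟ y)
... | yes hit = hit
injective⇒surjective {suc m} {f} inj y | no miss =
  contradiction (Fin.injective⇒≤ {f = λ x → punchOut (y≢f x)}
    (λ eq → inj (Fin.punchOut-injective (y≢f _) (y≢f _) eq))) ℕ.1+n≰n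
  where
  y≢f : ∀ x → y ≢ f x
  y≢f x eq = miss (x , sym eq)

uniform-bound : ∀ m (P : Fin m → ℕ → Set) → (∀ i {k l} → k ≤ l → P i k → P i l) →
  (∀ i → ∃[ k ] P i k) → ∃[ k ] (∀ i → P i k)
uniform-bound zero    P mono bound = 0 , λ ()
uniform-bound (suc m) P mono bound
  with k , pk ← bound zero | l , pl ← uniform-bound m (P ∘ suc) (λ i → mono (suc i)) (bound ∘ suc)
  = k ℕ.⊔ l , λ { zero → mono zero (ℕ.m≤m⊔n k l) pk ; (suc i) → mono (suc i) (ℕ.m≤n⊔m k l) (pl i) }

-- Communication of labelings under sliding

module _ {n : ℕ} (adj : Adj n) where

  private
    V : Set
    V = Fin (suc n)

  -- The index bounds the number of slides from above.
  data Reach : ℕ → V → Labeling n → V → Labeling n → Set where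
    done : ∀ {k v f g} → f ≗ g → Reach k v f v g
    step : ∀ {k v f w v′ g} → adjR adj v w ≡ true → Reach k w (swapAt f v w) v′ g → Reach (suc k) v f v′ g

  Reach-mono : ∀ {k l v f w g} → k ≤ l → Reach k v f w g → Reach l v f w g
  Reach-mono k≤l       (done f≗g) = done f≗g
  Reach-mono (s≤s k≤l) (step a p) = step a (Reach-mono k≤l p)

  -- As `done` stops at a labeling that is only pointwise equal to the target, concatenation has to
  -- move the second path to another starting labeling.
  Reach-respˡ : ∀ {k v f f′ w g} → f ≗ f′ → Reach k v f′ w g → Reach k v f w g
  Reach-respˡ f≗f′ (done f′≗g) = done (λ x → trans (f≗f′ x) (f′≗g x))
  Reach-respˡ f≗f′ (step a p)  = step a (Reach-respˡ (swapAt-cong f≗f′ _ _) p)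

  Reach-trans : ∀ {k l v₁ f₁ v₂ f₂ v₃ f₃} →
    Reach k v₁ f₁ v₂ f₂ → Reach l v₂ f₂ v₃ f₃ → Reach (k ℕ.+ l) v₁ f₁ v₃ f₃
  Reach-trans {k} {l} (done f≗g) q = Reach-mono (ℕ.m≤n+m l k) (Reach-respˡ f≗g q)
  Reach-trans (step a p) q = step a (Reach-trans p q)

  module _ (simple : IsSimple adj) where

    adj⇒≢ : ∀ {u v} → adj u v ≡ true → u ≢ v
    adj⇒≢ {u} a refl with () ← trans (sym a) (proj₂ simple u)

    -- Sliding around the triangle 𝐫, u, v exchanges the labels of u and v.
    Reach-edge : ∀ {u v} → adj u v ≡ true → ∀ f → Reach 3 𝐫 f 𝐫 (swapAt f (suc u) (suc v))
    Reach-edge {u} {v} a f = step {w = suc u} refl (step {w = suc v} a (step {w = 𝐫} refl (done λ x →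
      trans (swapAt³-transpose f 𝐫 (suc u) (suc u) (suc v) (suc v) 𝐫 x)
        (trans (cong f (transpose-triangle (λ ()) (adj⇒≢ a ∘ Fin.suc-injective) (λ ()) x))
          (sym (swapAt-transpose f (suc u) (suc v) x))))))

    -- Induction on the path: the swap of u and v is the swap of w and v conjugated by that of the
    -- edge u, w. The conjugation identity needs three distinct vertices, so w = v and u = v are
    -- split off. The bound k depends on the path alone and serves all labelings.
    Reach-swap : ∀ {u v} → Star (λ a b → adj a b ≡ true) u v →
      ∃[ k ] (∀ f → Reach k 𝐫 f 𝐫 (swapAt f (suc u) (suc v)))
    Reach-swap {u} Path.ε = 0 , λ f → done (λ x → sym (trans (swapAt-transpose f (suc u) (suc u) x)
      (cong f (transpose-refl (suc u) x))))
    Reach-swap {u} {v} (_◅_ {j = w} a path) with Reach-swap path | u Fin.≟ v | w Fin.≟ v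
    ... | k , reach | _ | yes refl = 3 , Reach-edge a
    ... | k , reach | yes refl | no _ = Reach-swap {u} Path.ε
    ... | k , reach | no u≢v | no w≢v = 3 ℕ.+ (k ℕ.+ 3) , λ f →
      Reach-trans (Reach-edge a f) (Reach-trans (reach _)
        (Reach-trans {l = 0} (Reach-edge a _) (done (λ x →
          trans (swapAt³-transpose f (suc u) (suc w) (suc w) (suc v) (suc u) (suc w) x)
            (trans (cong f (transpose-conjugate (adj⇒≢ a ∘ Fin.suc-injective)
                (w≢v ∘ Fin.suc-injective) (u≢v ∘ Fin.suc-injective) x))
              (sym (swapAt-transpose f (suc u) (suc v) x)))))))

    -- Selection sort, with k the number of vertices of G still to be treated. The label wanted at
    -- vertex k-1 is found at some j and fetched by one swap; injectivity keeps j away from 𝐫 and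
    -- from the vertices already settled. Where j lies depends on f, but the bound is chosen before
    -- f, hence the maximum over all j in `uniform-bound`.
    Reach-sort : Connected adj → ∀ k → k ≤ n → ∃[ D ] (∀ f g → Injective _≡_ _≡_ f → Injective _≡_ _≡_ g →
      f 𝐫 ≡ g 𝐫 → (∀ u → k ≤ toℕ u → f (suc u) ≡ g (suc u)) → Reach D 𝐫 f 𝐫 g)
    Reach-sort conn zero k≤n = 0 , λ f g _ _ r≡ rest → done λ { zero → r≡ ; (suc u) → rest u z≤n }
    Reach-sort conn (suc k) k<n
      with D , sort ← Reach-sort conn k (ℕ.<⇒≤ k<n)
         | L , swap ← uniform-bound n (λ j L → ∀ f → Reach L 𝐫 f 𝐫 (swapAt f (suc (fromℕ< k<n)) (suc j)))
                        (λ j k≤l r f → Reach-mono k≤l (r f)) (λ j → Reach-swap (conn _ j))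
      = L ℕ.+ D , go
      where
      i : Fin n
      i = fromℕ< k<n
      go : ∀ f g → Injective _≡_ _≡_ f → Injective _≡_ _≡_ g →
        f 𝐫 ≡ g 𝐫 → (∀ u → suc k ≤ toℕ u → f (suc u) ≡ g (suc u)) → Reach (L ℕ.+ D) 𝐫 f 𝐫 g
      go f g f-inj g-inj r≡ rest with injective⇒surjective f-inj (g (suc i))
      ... | zero , fj≡gi with () ← g-inj (trans (sym r≡) fj≡gi)
      ... | suc j , fj≡gi = Reach-trans (swap j f) (sort f′ g (swapAt-injective f-inj (suc i) (suc j)) g-inj r≡ agree)
        where
        f′ = swapAt f (suc i) (suc j)
        agree : ∀ u → k ≤ toℕ u → f′ (suc u) ≡ g (suc u)
        agree u k≤u with u Fin.≟ i
        ... | yes refl = trans (swapAt-transpose f (suc i) (suc j) (suc i))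
          (trans (cong f (transpose-left (suc i) (suc j))) fj≡gi)
        ... | no u≢i = trans (swapAt-transpose f (suc i) (suc j) (suc u))
          (trans (cong f (transpose-other (suc i) (suc j) (suc u) (u≢i ∘ Fin.suc-injective) u≢j)) fu≡gu)
          where
          k<u : suc k ≤ toℕ u
          k<u = ℕ.≤∧≢⇒< k≤u (λ k≡u → u≢i (Fin.toℕ-injective (trans (sym k≡u) (sym (Fin.toℕ-fromℕ< k<n)))))
          fu≡gu : f (suc u) ≡ g (suc u)
          fu≡gu = rest u k<u
          u≢j : suc u ≢ suc j
          u≢j refl = u≢i (Fin.suc-injective (g-inj (trans (sym fu≡gu) fj≡gi)))

    -- As 𝐫 is adjacent to all other vertices, at most one slide takes the moving label to 𝐫, where
    -- sorting is possible, and at most one slide takes it to its final place. The hypothesis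
    -- `f v ≡ g w` makes the two labels at 𝐫 agree.
    Reach-all : Connected adj → ∃[ D ] (∀ v f w g → Injective _≡_ _≡_ f → Injective _≡_ _≡_ g →
      f v ≡ g w → Reach D v f w g)
    Reach-all conn with D , sort ← Reach-sort conn n ℕ.≤-refl = 1 ℕ.+ (D ℕ.+ 1) , go
      where
      none : ∀ (f g : Labeling n) u → n ≤ toℕ u → f (suc u) ≡ g (suc u)
      none f g u n≤u = contradiction (Fin.toℕ<n u) (ℕ.≤⇒≯ n≤u)
      toR : ∀ v f → ∃[ h ] (Injective _≡_ _≡_ f → Injective _≡_ _≡_ h) × (h 𝐫 ≡ f v) ×
        Reach 1 v f 𝐫 h × Reach 1 𝐫 h v f
      toR zero    f = f , (λ inj → inj) , refl , done (λ _ → refl) , done (λ _ → refl)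
      toR (suc u) f = swapAt f (suc u) 𝐫 , (λ inj → swapAt-injective inj (suc u) 𝐫) , refl
        , step refl (done (λ _ → refl))
        , step refl (done (λ x → trans (swapAt-transpose (swapAt f (suc u) 𝐫) 𝐫 (suc u) x)
            (trans (swapAt-transpose f (suc u) 𝐫 (transpose 𝐫 (suc u) x)) (cong f (transpose-inverse (suc u) 𝐫)))))
      go : ∀ v f w g → Injective _≡_ _≡_ f → Injective _≡_ _≡_ g → f v ≡ g w → Reach (1 ℕ.+ (D ℕ.+ 1)) v f w g
      go v f w g f-inj g-inj fv≡gw with toR v f | toR w g
      ... | f′ , f′-inj , f′r , there′ , _ | g′ , g′-inj , g′r , _ , back =
        Reach-trans there′ (Reach-trans
          (sort f′ g′ (f′-inj f-inj) (g′-inj g-inj) (trans f′r (trans fv≡gw (sym g′r))) (none f′ g′)) back)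

-- Neighbour lists

module _ {m : ℕ} (a : Adj m) (v : Fin m) where

  private
    select : Fin m → List (Fin m)
    select w = if a v w then [ w ] else []

  adj-select : ∀ {w us} → a v w ≡ true → w ∈ us → w ∈ concatMap select us
  adj-select {w} eq (here refl) rewrite eq = here refl
  adj-select {us = u ∷ us} eq (there w∈) with a v u
  ... | true  = there (adj-select eq w∈)
  ... | false = adj-select eq w∈

  length-select : ∀ us → length (concatMap select us) ≤ length us
  length-select []       = z≤n
  length-select (u ∷ us) with a v u
  ... | true  = s≤s (length-select us)
  ... | false = ℕ.m≤n⇒m≤1+n (length-select us)

  ∈-neighbours⁺ : ∀ {w} → a v w ≡ true → w ∈ neighbours a v
  ∈-neighbours⁺ eq = adj-select eq (∈-allFin _)

  length-neighbours : length (neighbours a v) ≤ m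
  length-neighbours = subst (length (neighbours a v) ≤_) (length-tabulate id) (length-select (allFin m))

-- Expected visit counts and their oscillation

-- Different sequences of slides may lead to labelings that agree only pointwise; such events do not
-- tell their orientations apart.
Extensional : ∀ {m} → (Orient m → Bool) → Set
Extensional E = ∀ {o o′} → (∀ u v → o u v ≡ o′ u v) → E o ≡ E o′

-- The states of the process: v is the vertex that carries the label n+1.
Valid : ∀ {n} → Fin (suc n) → Labeling n → Set
Valid {n} v f = Injective _≡_ _≡_ f × f v ≡ fromℕ n

Valid-step : ∀ {n v} {f : Labeling n} → Valid v f → ∀ w → Valid w (swapAt f v w)
Valid-step {v = v} {f} (inj , fv) w = swapAt-injective inj v w ,
  trans (swapAt-transpose f v w w) (trans (cong f (transpose-right v w)) fv)

-- The geometric sum d + d² + ... + d^j. The recursion is dictated by one step of the process: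
-- division of `gap d (suc j)` by d leaves 1, which pays for the reward, and `gap d j`, which is the
-- advantage still owed.
gap : ℕ → ℕ → ℚ
gap d zero    = 0ℚ
gap d (suc j) = ι d * (1ℚ + gap d j)

gap-nonNeg : ∀ d j → 0ℚ ℚ.≤ gap d j
gap-nonNeg d zero    = ℚ.≤-refl
gap-nonNeg d (suc j) = 0≤* (0≤ι d) (0≤+ 0≤1 (gap-nonNeg d j))

gap-mono : ∀ d {i j} → i ≤ j → gap d i ℚ.≤ gap d j
gap-mono d {j = j} z≤n = gap-nonNeg d j
gap-mono d (s≤s i≤j)   = ℚ.*-monoˡ-≤-nonNeg (ι d) {{ι-nonNeg d}} (ℚ.+-monoʳ-≤ 1ℚ (gap-mono d i≤j))

module _ {n : ℕ} (adj : Adj n) where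

  module _ (E : Orient (suc n) → Bool) where

    P : ℕ → Fin (suc n) → Labeling n → ℚ
    P t v f = Prob adj t v f E

    S : ℕ → Fin (suc n) → Labeling n → ℚ
    S N v f = PartialSum adj N v f E

    P-nonNeg : ∀ t v f → 0ℚ ℚ.≤ P t v f
    P-nonNeg zero    v f = indicator-nonNeg (E (orientOf adj f))
    P-nonNeg (suc t) v f = average-nonNeg (All.map⁺ (All.tabulate {xs = neighbours (adjR adj) v}
      (λ {w} _ → P-nonNeg t w (swapAt f v w))))

    P₁≤1 : ∀ v f → P 1 v f ℚ.≤ 1ℚ
    P₁≤1 v f with neighbours (adjR adj) v
    ... | []     = 0≤1
    ... | w ∷ ws = subst (ℚ._≤ 1ℚ) (ℚ.+-identityʳ _)
      (average-upper {g = 0ℚ} {d = suc (length ws)} F ℕ.≤-refl ℚ.≤-refl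
        (All.tabulate {xs = w ∷ ws} (λ {w} _ → bound w))
        (here (subst (ℚ._≤ 1ℚ)
          (sym (trans (cong (λ z → F w + z) (ℚ.*-zeroʳ (ι (suc (length ws))))) (ℚ.+-identityʳ (F w)))) (bound w))))
      where
      F : Fin (suc n) → ℚ
      F w = P 0 w (swapAt f v w)
      bound : ∀ w → F w ℚ.≤ 1ℚ
      bound w = indicator≤1 (E (orientOf adj (swapAt f v w)))

    -- `Prob` conditions on the first slide, so the times 2, ..., N+1 from here are the times 1,
    -- ..., N from the neighbours. The term for time 1 remains as the reward.
    S-step : ∀ N v f → S (suc N) v f ≡
      P 1 v f + average (map (λ w → S N w (swapAt f v w)) (neighbours (adjR adj) v))
    S-step zero    v f = trans (ℚ.+-comm 0ℚ (P 1 v f))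
      (cong (λ z → P 1 v f + z) (sym (average-0 (neighbours (adjR adj) v))))
      where
      average-0 : ∀ {A : Set} (xs : List A) → average (map (λ _ → 0ℚ) xs) ≡ 0ℚ
      average-0 xs with s , eq ← average-scale xs = trans (eq _) (trans (cong (s *_) (sumℚ-map-0 xs)) (ℚ.*-zeroʳ s))
    S-step (suc N) v f = trans (cong (_+ P (suc (suc N)) v f) (S-step N v f))
      (trans (ℚ.+-assoc (P 1 v f) _ _) (cong (λ z → P 1 v f + z) (sym (average-map-+ _ _ (neighbours (adjR adj) v)))))

    S-mono : ∀ {M N} → M ≤ N → ∀ v f → S M v f ℚ.≤ S N v f
    S-mono M≤N v f = go (ℕ.≤⇒≤′ M≤N)
      where
      go : ∀ {M N} → M ℕ.≤′ N → S M v f ℚ.≤ S N v f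
      go (ℕ.≤′-reflexive refl)     = ℚ.≤-refl
      go {M} {suc N} (ℕ.≤′-step le) = ℚ.≤-trans (go le) (p≤p+q (S N v f) (P-nonNeg (suc N) v f))

    module _ (ext : Extensional E) where

      P-cong : ∀ t v {f g} → f ≗ g → P t v f ≡ P t v g
      P-cong zero    v f≗g = cong indicator (ext (λ x y → cong₂ (λ i j → adjR adj x y ∧ (i <ᵇ j)) (f≗g x) (f≗g y)))
      P-cong (suc t) v f≗g = average-map-cong {xs = neighbours (adjR adj) v}
        (All.tabulate (λ {w} _ → P-cong t w (swapAt-cong f≗g v w)))

      S-cong : ∀ N v {f g} → f ≗ g → S N v f ≡ S N v g
      S-cong zero    v f≗g = refl
      S-cong (suc N) v f≗g = cong₂ _+_ (S-cong N v f≗g) (P-cong (suc N) v f≗g)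

  module _ (E : Orient (suc n) → Bool) (ext : Extensional E) (D : ℕ) (v₁ : Fin (suc n)) (f₁ : Labeling n)
    (reach : ∀ v f → Valid v f → Reach adj D v f v₁ f₁) where

    -- Stated with j = D - k for a state at most k slides away from the target; as a state has at most
    -- n+1 neighbours, averaging divides the advantage gap (j+1) of one of them by at most n+1.
    S-gap : ∀ N {k} j v f → Valid v f → j ℕ.+ k ≡ D → Reach adj k v f v₁ f₁ →
      S E N v f + gap (suc n) j ℚ.≤ S E N v₁ f₁ + gap (suc n) D
    S-gap N {k} j v f valid j+k≡D (done f≗f₁) = ℚ.+-mono-≤ (ℚ.≤-reflexive (S-cong E ext N v f≗f₁))
      (gap-mono (suc n) (subst (j ≤_) j+k≡D (ℕ.m≤m+n j k)))
    S-gap zero {k} j v f valid j+k≡D (step a p) = ℚ.+-monoʳ-≤ 0ℚ (gap-mono (suc n) (subst (j ≤_) j+k≡D (ℕ.m≤m+n j k)))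
    S-gap (suc N) {suc k} j v f valid j+k≡D (step {w = w} a p) = begin
      S E (suc N) v f + gap (suc n) j               ≡⟨ cong (_+ gap (suc n) j) (S-step E N v f) ⟩
      P E 1 v f + avg + gap (suc n) j               ≤⟨ ℚ.+-monoˡ-≤ (gap (suc n) j) (ℚ.+-monoˡ-≤ avg (P₁≤1 E v f)) ⟩
      1ℚ + avg + gap (suc n) j                      ≡⟨ solve 2 (λ a g → con 1ℚ :+ a :+ g := a :+ (con 1ℚ :+ g)) refl
                                                         avg (gap (suc n) j) ⟩
      avg + (1ℚ + gap (suc n) j)                    ≤⟨ average-upper F (length-neighbours (adjR adj) v)
                                                         (0≤+ 0≤1 (gap-nonNeg (suc n) j)) all any ⟩
      S E N v₁ f₁ + gap (suc n) D                   ≤⟨ ℚ.+-monoˡ-≤ (gap (suc n) D) (S-mono E (ℕ.n≤1+n N) v₁ f₁) ⟩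
      S E (suc N) v₁ f₁ + gap (suc n) D             ∎
      where
      open ℚ.≤-Reasoning
      F : Fin (suc n) → ℚ
      F w = S E N w (swapAt f v w)
      avg : ℚ
      avg = average (map F (neighbours (adjR adj) v))
      -- An arbitrary first slide may lead away from the target. Since the induction is on N, each
      -- neighbour may start afresh with j = 0 and the path of at most D slides given by `reach`.
      all : All (λ w → F w ℚ.≤ S E N v₁ f₁ + gap (suc n) D) (neighbours (adjR adj) v)
      all = All.tabulate λ {w} _ → subst (ℚ._≤ S E N v₁ f₁ + gap (suc n) D) (ℚ.+-identityʳ (F w))
        (S-gap N 0 w (swapAt f v w) (Valid-step valid w) refl (reach w _ (Valid-step valid w)))
      any : Any (λ w → F w + ι (suc n) * (1ℚ + gap (suc n) j) ℚ.≤ S E N v₁ f₁ + gap (suc n) D)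
        (neighbours (adjR adj) v)
      any = lose (∈-neighbours⁺ (adjR adj) v a)
        (S-gap N (suc j) w (swapAt f v w) (Valid-step valid w) (trans (sym (ℕ.+-suc j k)) j+k≡D) p)

    S-oscillation : ∀ N v f → Valid v f → S E N v f ℚ.≤ S E N v₁ f₁ + gap (suc n) D
    S-oscillation N v f valid = subst (ℚ._≤ S E N v₁ f₁ + gap (suc n) D) (ℚ.+-identityʳ (S E N v f))
      (S-gap N 0 v f valid refl (reach v f valid))

  -- Recurrence: the expected number of visits to S_𝐫 diverges

  module _ (E : Orient (suc n) → Bool) (detect : ∀ v f → Valid v f → E (orientOf adj f) ≡ (v ==ᶠ 𝐫)) (1≤n : 1 ≤ n)
    (δ : ℚ) (0<δ : 0ℚ < δ) (dδ≡1 : ι (suc n) * δ ≡ 1ℚ) where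

    0≤δ : 0ℚ ℚ.≤ δ
    0≤δ = ℚ.<⇒≤ 0<δ

    -- An empty average is 0 and would destroy the lower bound δ; for n ≥ 1 the vertex 𝐫 has a
    -- neighbour as well.
    neighbour : ∀ v → ∃[ w ] adjR adj v w ≡ true
    neighbour zero    = suc (fromℕ< 1≤n) , refl
    neighbour (suc u) = zero , refl

    -- Two consecutive times are taken because n+1 must leave 𝐫 at every slide. At t = 0 either n+1
    -- is at 𝐫 already, or it moves there with probability at least δ = 1/(n+1), as a vertex has at
    -- most n+1 neighbours. Averaging over the first slide carries the bound to later times.
    P-recurrent : ∀ t v f → Valid v f → δ ℚ.≤ P E t v f + P E (suc t) v f
    P-recurrent zero v@zero f valid = ℚ.≤-trans (subst (δ ℚ.≤_) (trans dδ≡1 (sym P₀≡1)) δ≤ιδ)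
        (p≤p+q (P E 0 v f) (P-nonNeg E 1 v f))
      where
      P₀≡1 : P E 0 v f ≡ 1ℚ
      P₀≡1 = cong indicator (detect v f valid)
      δ≤ιδ : δ ℚ.≤ ι (suc n) * δ
      δ≤ιδ = subst (ℚ._≤ ι (suc n) * δ) (ℚ.*-identityˡ δ)
        (ℚ.*-monoʳ-≤-nonNeg δ {{ℚ.nonNegative 0≤δ}} (ι-mono {1} {suc n} (s≤s z≤n)))
    P-recurrent zero v@(suc u) f valid = ℚ.≤-trans
        (subst (ℚ._≤ P E 1 v f) (ℚ.+-identityˡ δ) (average-lower F (length-neighbours (adjR adj) v) 0≤δ
          (All.tabulate (λ {w} _ → P-nonNeg E 0 w (swapAt f v w)))
          (lose (∈-neighbours⁺ (adjR adj) v {zero} refl) (ℚ.≤-reflexive (trans (ℚ.+-identityˡ _)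
            (trans dδ≡1 (sym (cong indicator (detect zero _ (Valid-step valid zero))))))))))
        (p≤q+p (P E 1 v f) (P-nonNeg E 0 v f))
      where
      F : Fin (suc n) → ℚ
      F w = P E 0 w (swapAt f v w)
    P-recurrent (suc t) v f valid = subst₂ ℚ._≤_ (ℚ.+-identityʳ δ) (average-map-+ _ _ (neighbours (adjR adj) v))
      (average-lower F (length-neighbours (adjR adj) v) ℚ.≤-refl (All.tabulate (λ {w} _ → bound w))
        (lose (∈-neighbours⁺ (adjR adj) v (proj₂ (neighbour v)))
          (subst (ℚ._≤ F w₀) (sym (trans (cong (λ z → δ + z) (ℚ.*-zeroʳ (ι (suc n)))) (ℚ.+-identityʳ δ))) (bound w₀))))
      where
      F : Fin (suc n) → ℚ
      F w = P E t w (swapAt f v w) + P E (suc t) w (swapAt f v w)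
      w₀ : Fin (suc n)
      w₀ = proj₁ (neighbour v)
      bound : ∀ w → δ ℚ.≤ F w
      bound w = P-recurrent t w (swapAt f v w) (Valid-step valid w)

    -- The times are grouped in pairs 2m+1, 2m+2, each contributing at least δ. The form `m ℕ.* 2`
    -- makes the successor step unfold to exactly two more terms of the partial sum.
    S-linear-growth : ∀ v f → Valid v f → ∀ m → ι m * δ ℚ.≤ S E (m ℕ.* 2) v f
    S-linear-growth v f valid zero    = ℚ.≤-reflexive (ℚ.*-zeroˡ δ)
    S-linear-growth v f valid (suc m) = begin
      ι (suc m) * δ        ≡⟨ cong (_* δ) (ι-suc m) ⟩
      (1ℚ + ι m) * δ       ≡⟨ solve 2 (λ i d → (con 1ℚ :+ i) :* d := i :* d :+ d) refl (ι m) δ ⟩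
      ι m * δ + δ          ≤⟨ ℚ.+-mono-≤ (S-linear-growth v f valid m) (P-recurrent (suc N) v f valid) ⟩
      S E N v f + (P E (1 ℕ.+ N) v f + P E (2 ℕ.+ N) v f) ≡⟨ ℚ.+-assoc (S E N v f) _ _ ⟨
      S E (2 ℕ.+ N) v f    ∎
      where
      open ℚ.≤-Reasoning
      N : ℕ
      N = m ℕ.* 2

    S-unbounded : ∀ v f → Valid v f → ∀ B → ∃[ N ] B < S E N v f
    S-unbounded v f valid B = exceed (archimedean (ι (suc n) * B))
      where
      cancel : ∀ d → d * δ ≡ 1ℚ → d * B * δ ≡ B
      cancel d dδ≡1 = trans (solve 3 (λ d b i → d :* b :* i := d :* i :* b) refl d B δ)
        (trans (cong (_* B) dδ≡1) (ℚ.*-identityˡ B))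
      exceed : ∃[ m ] ι (suc n) * B < ι m → ∃[ N ] B < S E N v f
      exceed (m , lt) = m ℕ.* 2 , ℚ.<-≤-trans
        (subst (_< ι m * δ) (cancel (ι (suc n)) dδ≡1) (ℚ.*-monoˡ-<-pos δ {{ℚ.positive 0<δ}} lt))
        (S-linear-growth v f valid m)

-- Counting functions by Boolean tests

true-ext : ∀ {a b : Bool} → (a ≡ true → b ≡ true) → (b ≡ true → a ≡ true) → a ≡ b
true-ext {true}  {b}     a⇒b b⇒a = sym (a⇒b refl)
true-ext {false} {false} a⇒b b⇒a = refl
true-ext {false} {true}  a⇒b b⇒a = b⇒a refl

≢true⇒≡false : ∀ {b : Bool} → b ≢ true → b ≡ false
≢true⇒≡false {true}  b≢true = contradiction refl b≢true
≢true⇒≡false {false} b≢true = refl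

∧-true : ∀ {a b} → a ∧ b ≡ true → a ≡ true × b ≡ true
∧-true {true} {true} _ = refl , refl

allᵇ-allFin⁻ : ∀ {m} {p : Fin m → Bool} → allᵇ p (allFin m) ≡ true → ∀ i → p i ≡ true
allᵇ-allFin⁻ {m} {p} eq i = go (allFin m) eq (∈-allFin i)
  where
  go : ∀ xs → allᵇ p xs ≡ true → i ∈ xs → p i ≡ true
  go (x ∷ xs) eq (here refl) = proj₁ (∧-true eq)
  go (x ∷ xs) eq (there i∈)  = go xs (proj₂ (∧-true {p x} eq)) i∈

allᵇ-allFin⁺ : ∀ {m} {p : Fin m → Bool} → (∀ i → p i ≡ true) → allᵇ p (allFin m) ≡ true
allᵇ-allFin⁺ {m} {p} eq = go (allFin m)
  where
  go : ∀ xs → allᵇ p xs ≡ true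
  go []       = refl
  go (x ∷ xs) rewrite eq x = go xs

module _ {A : Set} where

  countTrue-cong : ∀ {p q : A → Bool} {xs} → All (λ x → p x ≡ q x) xs → countTrue p xs ≡ countTrue q xs
  countTrue-cong []         = refl
  countTrue-cong (eq ∷ eqs) = cong₂ ℕ._+_ (cong (λ b → if b then 1 else 0) eq) (countTrue-cong eqs)

  countTrue-≗ : ∀ {p q : A → Bool} → p ≗ q → ∀ xs → countTrue p xs ≡ countTrue q xs
  countTrue-≗ eq xs = countTrue-cong (All.tabulate {xs = xs} (λ {x} _ → eq x))

  countTrue-none : ∀ {p : A → Bool} → (∀ x → p x ≡ false) → ∀ xs → countTrue p xs ≡ 0
  countTrue-none eq []       = refl
  countTrue-none eq (x ∷ xs) rewrite eq x = countTrue-none eq xs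

  countTrue-++ : ∀ (p : A → Bool) xs ys → countTrue p (xs ++ ys) ≡ countTrue p xs ℕ.+ countTrue p ys
  countTrue-++ p []       ys = refl
  countTrue-++ p (x ∷ xs) ys = trans (cong (_ ℕ.+_) (countTrue-++ p xs ys))
    (sym (ℕ.+-assoc (if p x then 1 else 0) (countTrue p xs) (countTrue p ys)))

  countTrue-map : ∀ {B : Set} (p : A → Bool) (h : B → A) xs → countTrue p (map h xs) ≡ countTrue (p ∘ h) xs
  countTrue-map p h []       = refl
  countTrue-map p h (x ∷ xs) = cong (_ ℕ.+_) (countTrue-map p h xs)

  countTrue-concatMap : ∀ {B : Set} (p : A → Bool) (h : B → List A) xs →
    countTrue p (concatMap h xs) ≡ sum (map (countTrue p ∘ h) xs)
  countTrue-concatMap p h []       = refl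
  countTrue-concatMap p h (x ∷ xs) = trans (countTrue-++ p (h x) _) (cong (_ ℕ.+_) (countTrue-concatMap p h xs))

  countTrue-filter : ∀ {p q : A → Bool} → (∀ x → p x ≡ true → q x ≡ true) → ∀ xs →
    countTrue p (filterᵇ q xs) ≡ countTrue p xs
  countTrue-filter p⇒q []       = refl
  countTrue-filter {p} {q} p⇒q (x ∷ xs) with q x in qx | p x in px
  ... | true  | true  rewrite px = cong suc (countTrue-filter p⇒q xs)
  ... | true  | false rewrite px = countTrue-filter p⇒q xs
  ... | false | false = countTrue-filter p⇒q xs
  ... | false | true with () ← trans (sym qx) (p⇒q x px)

  length-filter : ∀ (q : A → Bool) xs → length (filterᵇ q xs) ≡ countTrue q xs
  length-filter q []       = refl
  length-filter q (x ∷ xs) with q x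
  ... | true  = cong suc (length-filter q xs)
  ... | false = length-filter q xs

  All-filter : ∀ (q : A → Bool) xs → All (λ x → q x ≡ true) (filterᵇ q xs)
  All-filter q []       = []
  All-filter q (x ∷ xs) with q x in eq
  ... | true  = eq ∷ All-filter q xs
  ... | false = All-filter q xs

  countTrue-split : ∀ (p q : A → Bool) xs →
    countTrue (λ x → p x ∧ not (q x)) xs ℕ.+ countTrue (λ x → p x ∧ q x) xs ≡ countTrue p xs
  countTrue-split p q []       = refl
  countTrue-split p q (x ∷ xs) with p x | q x
  ... | true  | true  = trans (ℕ.+-suc _ _) (cong suc (countTrue-split p q xs))
  ... | true  | false = cong suc (countTrue-split p q xs)
  ... | false | _     = countTrue-split p q xs

  sum-indicator : ∀ (p : A → Bool) (c : ℕ) xs → sum (map (λ x → if p x then c else 0) xs) ≡ countTrue p xs ℕ.* c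
  sum-indicator p c []       = refl
  sum-indicator p c (x ∷ xs) with p x
  ... | true  = cong (c ℕ.+_) (sum-indicator p c xs)
  ... | false = sum-indicator p c xs

  sumℚ-indicator : ∀ (p : A → Bool) xs → sumℚ (map (indicator ∘ p) xs) ≡ ι (countTrue p xs)
  sumℚ-indicator p []       = refl
  sumℚ-indicator p (x ∷ xs) with p x
  ... | true  = trans (cong (λ s → 1ℚ + s) (sumℚ-indicator p xs)) (sym (ι-suc (countTrue p xs)))
  ... | false = trans (ℚ.+-identityˡ _) (sumℚ-indicator p xs)

countTrue-swap : ∀ {A B : Set} (q : A → B → Bool) xs ys →
  sum (map (λ x → countTrue (q x) ys) xs) ≡ sum (map (λ y → countTrue (λ x → q x y) xs) ys)
countTrue-swap q [] []       = refl
countTrue-swap q [] (y ∷ ys) = countTrue-swap q [] ys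
countTrue-swap q (x ∷ xs) ys = trans (cong (countTrue (q x) ys ℕ.+_) (countTrue-swap q xs ys)) (go ys)
  where
  go : ∀ ys → countTrue (q x) ys ℕ.+ sum (map (λ y → countTrue (λ x → q x y) xs) ys)
    ≡ sum (map (λ y → countTrue (λ x → q x y) (x ∷ xs)) ys)
  go []       = refl
  go (y ∷ ys) = trans
    (interchange ℕ.+-commutativeSemigroup
      (if q x y then 1 else 0) (countTrue (q x) ys) (countTrue (λ x → q x y) xs)
      (sum (map (λ y → countTrue (λ x → q x y) xs) ys)))
    (cong (countTrue (λ x → q x y) (x ∷ xs) ℕ.+_) (go ys))

count-single : ∀ {k} (a : Fin k) → countTrue (_==ᶠ a) (allFin k) ≡ 1
count-single {suc k} a = trans
    (cong (λ c → (if zero ==ᶠ a then 1 else 0) ℕ.+ c)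
      (trans (cong (countTrue (_==ᶠ a)) (sym (map-tabulate id suc)))
      (countTrue-map (_==ᶠ a) suc (allFin k)))) (go a)
  where
  go : ∀ a → (if zero ==ᶠ a then 1 else 0) ℕ.+ countTrue (λ i → suc i ==ᶠ a) (allFin k) ≡ 1
  go zero    = cong suc (countTrue-none (λ _ → refl) (allFin k))
  go (suc a) = count-single a

-- `allFuns` builds its entries by its own pattern-matching lambda, which agrees with `a F.∷ g` only
-- pointwise; hence the condition on p.
count-allFuns-suc : ∀ {m k} (p : (Fin (suc m) → Fin k) → Bool) → (∀ {f g} → f ≗ g → p f ≡ p g) →
  countTrue p (allFuns (suc m) k) ≡ sum (map (λ a → countTrue (λ g → p (a F.∷ g)) (allFuns m k)) (allFin k))
count-allFuns-suc {m} {k} p p-ext = trans (countTrue-concatMap p _ (allFin k))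
  (cong sum (map-cong (λ a → trans (countTrue-map p _ (allFuns m k))
    (countTrue-≗ (λ g → p-ext (λ { zero → refl ; (suc i) → refl })) (allFuns m k))) (allFin k)))

-- The counting lemmas take any test with a given specification, so that the induction may pass from
-- p to the test g ↦ p (a F.∷ g).
Characterises : ∀ {A : Set} → (A → Bool) → (A → Set) → Set
Characterises p Q = ∀ x → (p x ≡ true → Q x) × (Q x → p x ≡ true)

characterised-ext : ∀ {A : Set} {p : A → Bool} {Q} → Characterises p Q → ∀ {x y} →
  (Q x → Q y) → (Q y → Q x) → p x ≡ p y
characterised-ext char {x} {y} x⇒y y⇒x = true-ext
  (proj₂ (char y) ∘ x⇒y ∘ proj₁ (char x)) (proj₂ (char x) ∘ y⇒x ∘ proj₁ (char y))

-- In effect, `allFuns` lists every function exactly once up to pointwise equality. Only the first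
-- value a = ρ 0 contributes to the sum, and there the induction applies.
count-unique : ∀ m {k} (ρ : Fin m → Fin k) p → Characterises p (_≗ ρ) → countTrue p (allFuns m k) ≡ 1
count-unique zero    ρ p char = cong (λ b → (if b then 1 else 0) ℕ.+ 0) (proj₂ (char (λ ())) (λ ()))
count-unique (suc m) {k} ρ p char = trans
  (count-allFuns-suc p (λ f≗g → characterised-ext char
    (λ f≗ρ i → trans (sym (f≗g i)) (f≗ρ i)) (λ g≗ρ i → trans (f≗g i) (g≗ρ i))))
  (trans (cong sum (map-cong inner (allFin k)))
    (trans (sum-indicator (_==ᶠ ρ zero) 1 (allFin k)) (cong (ℕ._* 1) (count-single (ρ zero)))))
  where
  inner : ∀ a → countTrue (λ g → p (a F.∷ g)) (allFuns m k) ≡ (if a ==ᶠ ρ zero then 1 else 0)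
  inner a with a ==ᶠ ρ zero in eq
  ... | true  = count-unique m (ρ ∘ suc) (λ g → p (a F.∷ g)) λ g →
    (λ pg i → proj₁ (char (a F.∷ g)) pg (suc i)) ,
    (λ g≗ → proj₂ (char (a F.∷ g)) (λ { zero → ==ᶠ⇒≡ a (ρ zero) eq ; (suc i) → g≗ i }))
  ... | false = countTrue-none (λ g → ≢true⇒≡false (λ pg →
    contradiction (trans (sym eq) (trans (cong (_==ᶠ ρ zero) (proj₁ (char (a F.∷ g)) pg zero)) (==ᶠ-refl (ρ zero))))
      (λ ()))) (allFuns m k)

-- The set `avail` of values still allowed makes the induction work: any of its m+1 elements may be
-- the first value, and removing it leaves m for the rest.
count-injective : ∀ m {k} (avail : Fin k → Bool) → countTrue avail (allFin k) ≡ m →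
  ∀ p → Characterises {Fin m → Fin k} p (λ g → Injective _≡_ _≡_ g × (∀ i → avail (g i) ≡ true)) →
  countTrue p (allFuns m k) ≡ m !
count-injective zero    avail #avail p char = cong (λ b → (if b then 1 else 0) ℕ.+ 0)
  (proj₂ (char (λ ())) ((λ { {()} }) , λ ()))
count-injective (suc m) {k} avail #avail p char = trans
  (count-allFuns-suc p (λ f≗g → characterised-ext char (transfer f≗g) (transfer (sym ∘ f≗g))))
  (trans (cong sum (map-cong inner (allFin k)))
    (trans (sum-indicator avail (m !) (allFin k)) (cong (ℕ._* m !) #avail)))
  where
  transfer : ∀ {f g : Fin (suc m) → Fin k} → f ≗ g → Injective _≡_ _≡_ f × (∀ i → avail (f i) ≡ true) →
    Injective _≡_ _≡_ g × (∀ i → avail (g i) ≡ true)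
  transfer f≗g (inj , av) = (λ {i} {j} eq → inj (trans (f≗g i) (trans eq (sym (f≗g j))))) ,
    λ i → trans (cong avail (sym (f≗g i))) (av i)
  inner : ∀ a → countTrue (λ g → p (a F.∷ g)) (allFuns m k) ≡ (if avail a then m ! else 0)
  inner a with avail a in eq
  ... | false = countTrue-none (λ g → ≢true⇒≡false (λ pg →
    contradiction (trans (sym eq) (proj₂ (proj₁ (char (a F.∷ g)) pg) zero)) (λ ()))) (allFuns m k)
  ... | true  = count-injective m avail′ #avail′ (λ g → p (a F.∷ g)) (λ g → to g , from g)
    where
    avail′ : Fin k → Bool
    avail′ x = avail x ∧ not (x ==ᶠ a)
    just-a : ∀ x → (avail x ∧ (x ==ᶠ a)) ≡ (x ==ᶠ a)
    just-a x with x ==ᶠ a in x≡a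
    ... | true  = trans (∧-identityʳ (avail x)) (trans (cong avail (==ᶠ⇒≡ x a x≡a)) eq)
    ... | false = ∧-zeroʳ (avail x)
    #avail′ : countTrue avail′ (allFin k) ≡ m
    #avail′ = ℕ.suc-injective (trans (ℕ.+-comm 1 _) (trans
      (cong (countTrue avail′ (allFin k) ℕ.+_) (sym (trans (countTrue-≗ just-a (allFin k)) (count-single a))))
      (trans (countTrue-split avail (_==ᶠ a) (allFin k)) #avail)))
    to : ∀ g → p (a F.∷ g) ≡ true → Injective _≡_ _≡_ g × (∀ i → avail′ (g i) ≡ true)
    to g pg with inj , av ← proj₁ (char (a F.∷ g)) pg =
      (λ eq → Fin.suc-injective (inj eq)) ,
      λ i → cong₂ _∧_ (av (suc i)) (cong not (≢⇒==ᶠ (λ gi≡a → contradiction (inj {suc i} {zero} gi≡a) (λ ()))))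
    from : ∀ g → Injective _≡_ _≡_ g × (∀ i → avail′ (g i) ≡ true) → p (a F.∷ g) ≡ true
    from g (inj , av) = proj₂ (char (a F.∷ g)) (inj′ , λ { zero → eq ; (suc i) → proj₁ (∧-true (av i)) })
      where
      fresh : ∀ i → g i ≢ a
      fresh i gi≡a = contradiction (trans (sym (cong not (trans (cong (_==ᶠ a) gi≡a) (==ᶠ-refl a))))
        (proj₂ (∧-true {avail (g i)} (av i)))) (λ ())
      inj′ : Injective _≡_ _≡_ (a F.∷ g)
      inj′ {zero}  {zero}  _  = refl
      inj′ {zero}  {suc j} eq = contradiction (sym eq) (fresh j)
      inj′ {suc i} {zero}  eq = contradiction eq (fresh i)
      inj′ {suc i} {suc j} eq = cong suc (inj eq)

-- Double counting of the pairs (σ , ρ) with ρ = σ ∘ τ.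
count-precompose : ∀ {m k} (p : (Fin m → Fin k) → Bool) → (∀ {f g} → f ≗ g → p f ≡ p g) →
  ∀ {τ : Fin m → Fin m} → Injective _≡_ _≡_ τ →
  countTrue (λ σ → p (σ ∘ τ)) (allFuns m k) ≡ countTrue p (allFuns m k)
count-precompose {m} {k} p p-ext {τ} τ-inj = begin
  countTrue (λ σ → p (σ ∘ τ)) (allFuns m k)
    ≡⟨ asSum (λ σ → p (σ ∘ τ)) ⟩
  sum (map (λ σ → if p (σ ∘ τ) then 1 else 0) (allFuns m k))
    ≡⟨ cong sum (map-cong row (allFuns m k)) ⟨
  sum (map (λ σ → countTrue (λ ρ → p ρ ∧ same ρ σ) (allFuns m k)) (allFuns m k))
    ≡⟨ countTrue-swap (λ σ ρ → p ρ ∧ same ρ σ) (allFuns m k) (allFuns m k) ⟩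
  sum (map (λ ρ → countTrue (λ σ → p ρ ∧ same ρ σ) (allFuns m k)) (allFuns m k))
    ≡⟨ cong sum (map-cong column (allFuns m k)) ⟩
  sum (map (λ ρ → if p ρ then 1 else 0) (allFuns m k))
    ≡⟨ asSum p ⟨
  countTrue p (allFuns m k) ∎
  where
  open ≡-Reasoning
  same : (Fin m → Fin k) → (Fin m → Fin k) → Bool
  same ρ σ = allᵇ (λ i → ρ i ==ᶠ σ (τ i)) (allFin m)
  same⁻ : ∀ ρ σ → same ρ σ ≡ true → ρ ≗ σ ∘ τ
  same⁻ ρ σ eq i = ==ᶠ⇒≡ _ _ (allᵇ-allFin⁻ eq i)
  same⁺ : ∀ ρ σ → ρ ≗ σ ∘ τ → same ρ σ ≡ true
  same⁺ ρ σ eq = allᵇ-allFin⁺ (λ i → trans (cong (_==ᶠ σ (τ i)) (eq i)) (==ᶠ-refl (σ (τ i))))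
  τ⁻¹ : Fin m → Fin m
  τ⁻¹ y = proj₁ (injective⇒surjective τ-inj y)
  ττ⁻¹ : ∀ y → τ (τ⁻¹ y) ≡ y
  ττ⁻¹ y = proj₂ (injective⇒surjective τ-inj y)
  asSum : ∀ (q : (Fin m → Fin k) → Bool) →
    countTrue q (allFuns m k) ≡ sum (map (λ σ → if q σ then 1 else 0) (allFuns m k))
  asSum q = sym (trans (sum-indicator q 1 (allFuns m k)) (ℕ.*-identityʳ _))
  row : ∀ σ → countTrue (λ ρ → p ρ ∧ same ρ σ) (allFuns m k) ≡ (if p (σ ∘ τ) then 1 else 0)
  row σ with p (σ ∘ τ) in eq
  ... | true  = count-unique m (σ ∘ τ) _ λ ρ → (λ h → same⁻ ρ σ (proj₂ (∧-true {p ρ} h))) ,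
    λ ρ≗ → cong₂ _∧_ (trans (p-ext ρ≗) eq) (same⁺ ρ σ ρ≗)
  ... | false = countTrue-none (λ ρ → ≢true⇒≡false (λ h → contradiction
    (trans (sym eq) (trans (sym (p-ext (same⁻ ρ σ (proj₂ (∧-true {p ρ} h))))) (proj₁ (∧-true h))))
    (λ ()))) (allFuns m k)
  column : ∀ ρ → countTrue (λ σ → p ρ ∧ same ρ σ) (allFuns m k) ≡ (if p ρ then 1 else 0)
  column ρ with p ρ
  ... | true  = count-unique m (ρ ∘ τ⁻¹) _ λ σ →
    (λ h y → trans (cong σ (sym (ττ⁻¹ y))) (sym (same⁻ ρ σ h (τ⁻¹ y)))) ,
    λ σ≗ → same⁺ ρ σ (λ i → trans (cong ρ (sym (τ-inj (ττ⁻¹ (τ i))))) (sym (σ≗ (τ i))))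
  ... | false = countTrue-none (λ _ → refl) (allFuns m k)

-- Linear extensions and permutations

isLinExt-char : ∀ {m} (o : Orient m) → Characterises (isLinExt o) (λ σ →
  Injective _≡_ _≡_ σ × (∀ u v → o u v ≡ true → (σ u <ᵇ σ v) ≡ true))
isLinExt-char {m} o σ = (λ ext → inj ext , ord ext) , from
  where
  to : isLinExt o σ ≡ true → ∀ u v →
    ((if u ==ᶠ v then true else not (σ u ==ᶠ σ v)) ≡ true) × ((if o u v then σ u <ᵇ σ v else true) ≡ true)
  to ext u v = ∧-true (allᵇ-allFin⁻ (allᵇ-allFin⁻ ext u) v)
  inj : isLinExt o σ ≡ true → Injective _≡_ _≡_ σ
  inj ext {u} {v} eq with u ==ᶠ v in u≡v | proj₁ (to ext u v)
  ... | true  | _ = ==ᶠ⇒≡ u v u≡v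
  ... | false | h rewrite eq | ==ᶠ-refl (σ v) with () ← h
  ord : isLinExt o σ ≡ true → ∀ u v → o u v ≡ true → (σ u <ᵇ σ v) ≡ true
  ord ext u v ouv with h ← proj₂ (to ext u v) rewrite ouv = h
  from : Injective _≡_ _≡_ σ × (∀ u v → o u v ≡ true → (σ u <ᵇ σ v) ≡ true) → isLinExt o σ ≡ true
  from (inj , ord) = allᵇ-allFin⁺ λ u → allᵇ-allFin⁺ λ v → cong₂ _∧_ (distinct u v) (ordered u v)
    where
    distinct : ∀ u v → (if u ==ᶠ v then true else not (σ u ==ᶠ σ v)) ≡ true
    distinct u v with u ==ᶠ v in u≡v
    ... | true  = refl
    ... | false = cong not (≢⇒==ᶠ (λ eq → contradiction
      (trans (sym u≡v) (trans (cong (_==ᶠ v) (inj eq)) (==ᶠ-refl v))) (λ ())))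
    ordered : ∀ u v → (if o u v then σ u <ᵇ σ v else true) ≡ true
    ordered u v with o u v in ouv
    ... | true  = ord u v ouv
    ... | false = refl

isLinExt-ext : ∀ {m} (o : Orient m) {σ ρ} → σ ≗ ρ → isLinExt o σ ≡ isLinExt o ρ
isLinExt-ext o {σ} {ρ} σ≗ρ = characterised-ext (isLinExt-char o) (transfer σ≗ρ) (transfer (sym ∘ σ≗ρ))
  where
  transfer : ∀ {σ ρ} → σ ≗ ρ → Injective _≡_ _≡_ σ × (∀ u v → o u v ≡ true → (σ u <ᵇ σ v) ≡ true) →
    Injective _≡_ _≡_ ρ × (∀ u v → o u v ≡ true → (ρ u <ᵇ ρ v) ≡ true)
  transfer σ≗ρ (inj , ord) = (λ {u} {v} eq → inj (trans (σ≗ρ u) (trans eq (sym (σ≗ρ v))))) ,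
    λ u v ouv → trans (cong₂ _<ᵇ_ (sym (σ≗ρ u)) (sym (σ≗ρ v))) (ord u v ouv)

-- For the empty relation the linear extensions are all permutations, so the test that defines `e`
-- also selects the symmetric group.
perms : ∀ n → List (Fin n → Fin n)
perms n = filterᵇ (isLinExt (λ _ _ → false)) (allFuns n n)

perms-injective : ∀ n → All (Injective _≡_ _≡_) (perms n)
perms-injective n = All.map {Q = Injective _≡_ _≡_}
  (λ {σ} eq → proj₁ (proj₁ (isLinExt-char (λ _ _ → false) σ) eq)) (All-filter _ (allFuns n n))

length-perms : ∀ n → length (perms n) ≡ n !
length-perms n = trans (length-filter _ (allFuns n n))
  (count-injective n (λ _ → true) (countAll n) _ λ σ →
    (λ eq → proj₁ (proj₁ (isLinExt-char (λ _ _ → false) σ) eq) , λ _ → refl) ,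
    λ h → proj₂ (isLinExt-char (λ _ _ → false) σ) (proj₁ h , λ _ _ ()))
  where
  count-true : ∀ {A : Set} (xs : List A) → countTrue (λ _ → true) xs ≡ length xs
  count-true []       = refl
  count-true (x ∷ xs) = cong suc (count-true xs)
  countAll : ∀ n → countTrue (λ _ → true) (allFin n) ≡ n
  countAll n = trans (count-true (allFin n)) (length-tabulate id)

-- Comparison and relabeling of labels

<ᵇ⁺ : ∀ {m} {i j : Fin m} → toℕ i ℕ.< toℕ j → (i <ᵇ j) ≡ true
<ᵇ⁺ lt = Equivalence.to T-≡ (ℕ.<⇒<ᵇ lt)

<ᵇ⁻ : ∀ {m} (i j : Fin m) → (i <ᵇ j) ≡ true → toℕ i ℕ.< toℕ j
<ᵇ⁻ i j eq = ℕ.<ᵇ⇒< (toℕ i) (toℕ j) (Equivalence.from T-≡ eq)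

<ᵇ-not : ∀ {m} {i j : Fin m} → i ≢ j → (i <ᵇ j) ≡ not (j <ᵇ i)
<ᵇ-not {i = i} {j} i≢j with j <ᵇ i in eq
... | true  = ≢true⇒≡false (λ lt → ℕ.<-asym (<ᵇ⁻ j i eq) (<ᵇ⁻ i j lt))
... | false = <ᵇ⁺ (ℕ.≤∧≢⇒< (ℕ.≮⇒≥ (λ lt → contradiction (trans (sym eq) (<ᵇ⁺ {i = j} {i} lt)) (λ ())))
  (i≢j ∘ Fin.toℕ-injective))

<ᵇ-top : ∀ {n} {i : Fin (suc n)} → i ≢ fromℕ n → (i <ᵇ fromℕ n) ≡ true
<ᵇ-top {n} {i} i≢top = <ᵇ⁺ (ℕ.≤∧≢⇒< (Fin.≤fromℕ i) (i≢top ∘ Fin.toℕ-injective))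

-- The action on the labels 1, ..., n. Keeping n+1 fixed leaves the position of the moving label,
-- and with it the random walk, unchanged.
relabel : ∀ {n} → (Fin n → Fin n) → Fin (suc n) → Fin (suc n)
relabel σ x with view x
... | ‵fromℕ         = fromℕ _
... | ‵inj₁ {i = i} _ = inject₁ (σ i)

relabel-fromℕ : ∀ {n} (σ : Fin n → Fin n) → relabel σ (fromℕ n) ≡ fromℕ n
relabel-fromℕ {n} σ rewrite view-fromℕ n = refl

relabel-inject₁ : ∀ {n} (σ : Fin n → Fin n) i → relabel σ (inject₁ i) ≡ inject₁ (σ i)
relabel-inject₁ σ i rewrite view-inject₁ i = refl

relabel-injective : ∀ {n} {σ : Fin n → Fin n} → Injective _≡_ _≡_ σ → Injective _≡_ _≡_ (relabel σ)
relabel-injective {n} {σ} inj {x} {y} eq with view x | view y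
... | ‵fromℕ  | ‵fromℕ  = refl
... | ‵fromℕ  | ‵inj₁ _ = contradiction eq Fin.fromℕ≢inject₁
... | ‵inj₁ _ | ‵fromℕ  = contradiction (sym eq) Fin.fromℕ≢inject₁
... | ‵inj₁ _ | ‵inj₁ _ = cong inject₁ (inj (Fin.inject₁-injective eq))

unTop : ∀ {n} (x : Fin (suc n)) → x ≢ fromℕ n → ∃[ i ] x ≡ inject₁ i
unTop x x≢top with view x
... | ‵fromℕ         = contradiction refl x≢top
... | ‵inj₁ {i = i} _ = i , refl

-- Orientations induced by labelings

module _ {n : ℕ} (adj : Adj n) (simple : IsSimple adj) where

  adjR-sym : ∀ u v → adjR adj u v ≡ adjR adj v u
  adjR-sym zero    zero    = refl
  adjR-sym zero    (suc v) = refl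
  adjR-sym (suc u) zero    = refl
  adjR-sym (suc u) (suc v) = proj₁ simple u v

  adjR-irrefl : ∀ u → adjR adj u u ≡ false
  adjR-irrefl zero    = refl
  adjR-irrefl (suc u) = proj₂ simple u

  orientOf-acyclic : ∀ {f} → Injective _≡_ _≡_ f → IsAcyclicOrientation (adjR adj) (orientOf adj f)
  orientOf-acyclic {f} inj = (λ u v o → proj₁ (∧-true o)) , anti , λ u cycle → ℕ.<-irrefl refl (increasing cycle)
    where
    anti : ∀ u v → adjR adj u v ≡ true → orientOf adj f u v ≡ not (orientOf adj f v u)
    anti u v a rewrite adjR-sym v u | a = <ᵇ-not (λ eq → contradiction
      (trans (sym a) (trans (cong (adjR adj u) (sym (inj eq))) (adjR-irrefl u))) (λ ()))
    edge : ∀ {u v} → orientOf adj f u v ≡ true → toℕ (f u) ℕ.< toℕ (f v)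
    edge {u} {v} o = <ᵇ⁻ (f u) (f v) (proj₂ (∧-true {adjR adj u v} o))
    increasing : ∀ {u v} → TransClosure (λ x y → orientOf adj f x y ≡ true) u v → toℕ (f u) ℕ.< toℕ (f v)
    increasing Plus.[ o ] = edge o
    increasing (o ∷ os)   = ℕ.<-trans (edge o) (increasing os)

  top-maximal : ∀ (f : Labeling n) v → f v ≡ fromℕ n → IsMaximal (orientOf adj f) v
  top-maximal f v fv w = ≢true⇒≡false (λ o → ℕ.<⇒≱
    (subst (λ x → toℕ x ℕ.< toℕ (f w)) fv (<ᵇ⁻ (f v) (f w) (proj₂ (∧-true {adjR adj v w} o)))) (Fin.≤fromℕ (f w)))

  top-above : ∀ {f v w} → Injective _≡_ _≡_ f → f v ≡ fromℕ n → adjR adj w v ≡ true → orientOf adj f w v ≡ true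
  top-above {f} {v} {w} inj fv a = cong₂ _∧_ a (trans (cong (f w <ᵇ_) fv) (<ᵇ-top (λ fw → contradiction
    (trans (sym a) (trans (cong (λ x → adjR adj x v) (inj (trans fw (sym fv)))) (adjR-irrefl v))) (λ ()))))

  orientOf-∈Sr : ∀ {f} → Valid 𝐫 f → InSr adj (orientOf adj f)
  orientOf-∈Sr {f} (inj , fr) = orientOf-acyclic inj , top-maximal f 𝐫 fr , unique
    where
    unique : ∀ u → IsMaximal (orientOf adj f) u → u ≡ 𝐫
    unique zero    _   = refl
    unique (suc u) max = contradiction (trans (sym (max 𝐫)) (top-above {w = suc u} inj fr refl)) (λ ())

  orientOf-∉Sr : ∀ {f u} → Valid (suc u) f → ¬ IsMaximal (orientOf adj f) 𝐫
  orientOf-∉Sr {f} {u} (inj , fu) max =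
    contradiction (trans (sym (max (suc u))) (top-above {w = 𝐫} inj fu refl)) (λ ())

  -- The vertex with label n+1 is above all its neighbours, and 𝐫 is adjacent to every other vertex.
  -- So 𝐫 is the unique maximal element when it carries n+1, and otherwise lies below the vertex
  -- that does.
  decS-detects : (decS : ∀ o → Dec (InSr adj o)) → ∀ v f → Valid v f → isYes (decS (orientOf adj f)) ≡ (v ==ᶠ 𝐫)
  decS-detects decS v f valid with decS (orientOf adj f)
  decS-detects decS zero    f valid | yes _    = refl
  decS-detects decS zero    f valid | no ∉Sr   = contradiction (orientOf-∈Sr valid) ∉Sr
  decS-detects decS (suc u) f valid | yes ∈Sr  = contradiction (proj₁ (proj₂ ∈Sr)) (orientOf-∉Sr valid)
  decS-detects decS (suc u) f valid | no _     = refl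

-- Both choose exactly one direction for each edge: an edge on which they differed would be reversed
-- in o, hence by inclusion also in o′, which cannot contain both directions.
orientation-⊆⇒≡ : ∀ {m} {a : Adj m} {o o′ : Orient m} → IsAcyclicOrientation a o → IsAcyclicOrientation a o′ →
  (∀ u v → o u v ≡ true → o′ u v ≡ true) → ∀ u v → o u v ≡ o′ u v
orientation-⊆⇒≡ {o = o} {o′} (_ , anti , _) (edge′ , anti′ , _) ⊆ u v = true-ext (⊆ u v) ⊇
  where
  ⊇ : o′ u v ≡ true → o u v ≡ true
  ⊇ o′uv with o v u in ovu
  ... | false = trans (anti u v (edge′ u v o′uv)) (cong not ovu)
  ... | true  = contradiction (trans (sym o′uv) (trans (anti′ u v (edge′ u v o′uv)) (cong not (⊆ v u ovu)))) (λ ())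

sameOrient⁻ : ∀ {m} (o o′ : Orient m) → sameOrient o o′ ≡ true → ∀ u v → o u v ≡ o′ u v
sameOrient⁻ o o′ eq u v = ==ᵇ⇒≡ (o u v) (o′ u v) (allᵇ-allFin⁻ (allᵇ-allFin⁻ eq u) v)
  where
  ==ᵇ⇒≡ : ∀ a b → (a ==ᵇ b) ≡ true → a ≡ b
  ==ᵇ⇒≡ true  true  _ = refl
  ==ᵇ⇒≡ false false _ = refl

sameOrient⁺ : ∀ {m} (o o′ : Orient m) → (∀ u v → o u v ≡ o′ u v) → sameOrient o o′ ≡ true
sameOrient⁺ o o′ eq = allᵇ-allFin⁺ λ u → allᵇ-allFin⁺ λ v →
  trans (cong (_==ᵇ o′ u v) (eq u v)) (==ᵇ-refl (o′ u v))
  where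
  ==ᵇ-refl : ∀ a → (a ==ᵇ a) ≡ true
  ==ᵇ-refl true  = refl
  ==ᵇ-refl false = refl

sameOrient-ext : ∀ {m} (O : Orient m) → Extensional (sameOrient O)
sameOrient-ext O {o} {o′} o≗o′ = true-ext
  (λ h → sameOrient⁺ O o′ (λ u v → trans (sameOrient⁻ O o h u v) (o≗o′ u v)))
  (λ h → sameOrient⁺ O o (λ u v → trans (sameOrient⁻ O o′ h u v) (sym (o≗o′ u v))))

-- Symmetry of the visit counts under relabeling

module _ {n : ℕ} (adj : Adj n) (simple : IsSimple adj) (O : Orient (suc n)) (O∈Sr : InSr adj O) where

  module _ {f : Labeling n} (f-valid : Valid 𝐫 f) where

    private
      f≢top : ∀ u → f (suc u) ≢ fromℕ n
      f≢top u eq = contradiction (proj₁ f-valid (trans eq (sym (proj₂ f-valid)))) (λ ())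

    -- When 𝐫 carries n+1, the other vertices carry exactly 1, ..., n; this is f on V read as a
    -- permutation.
    base : Fin n → Fin n
    base u = proj₁ (unTop (f (suc u)) (f≢top u))

    base-spec : ∀ u → f (suc u) ≡ inject₁ (base u)
    base-spec u = proj₂ (unTop (f (suc u)) (f≢top u))

    base-injective : Injective _≡_ _≡_ base
    base-injective {u} {v} eq = Fin.suc-injective (proj₁ f-valid
      (trans (base-spec u) (trans (cong inject₁ eq) (sym (base-spec v)))))

    relabel-base : ∀ (σ : Fin n → Fin n) u v →
      (relabel σ (f (suc u)) <ᵇ relabel σ (f (suc v))) ≡ (σ (base u) <ᵇ σ (base v))
    relabel-base σ u v = cong₂ ℕ._<ᵇ_ (below u) (below v)
      where
      below : ∀ u → toℕ (relabel σ (f (suc u))) ≡ toℕ (σ (base u))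
      below u = trans (cong (toℕ ∘ relabel σ) (base-spec u))
        (trans (cong toℕ (relabel-inject₁ σ (base u))) (Fin.toℕ-inject₁ (σ (base u))))

    -- Edges at 𝐫 point to 𝐫 on both sides, so only the edges of G matter. There it is enough that
    -- the labeling respects O, since included orientations of the same graph coincide.
    sameOrient-isLinExt : ∀ {σ : Fin n → Fin n} → Injective _≡_ _≡_ σ →
      sameOrient O (orientOf adj (relabel σ ∘ f)) ≡ isLinExt (restrictV O) (σ ∘ base)
    sameOrient-isLinExt {σ} σ-inj = true-ext to from
      where
      valid : Valid 𝐫 (relabel σ ∘ f)
      valid = proj₁ f-valid ∘ relabel-injective σ-inj , trans (cong (relabel σ) (proj₂ f-valid)) (relabel-fromℕ σ)
      to : sameOrient O (orientOf adj (relabel σ ∘ f)) ≡ true → isLinExt (restrictV O) (σ ∘ base) ≡ true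
      to same = proj₂ (isLinExt-char (restrictV O) (σ ∘ base)) (base-injective ∘ σ-inj , λ u v Ouv →
        trans (sym (relabel-base σ u v))
          (proj₂ (∧-true {adj u v} (trans
            (sym (sameOrient⁻ O (orientOf adj (relabel σ ∘ f)) same (suc u) (suc v))) Ouv))))
      from : isLinExt (restrictV O) (σ ∘ base) ≡ true → sameOrient O (orientOf adj (relabel σ ∘ f)) ≡ true
      from ext = sameOrient⁺ O _ (orientation-⊆⇒≡ (proj₁ O∈Sr) (orientOf-acyclic adj simple (proj₁ valid)) ⊆)
        where
        ⊆ : ∀ u v → O u v ≡ true → orientOf adj (relabel σ ∘ f) u v ≡ true
        ⊆ zero    v       Ouv = contradiction (trans (sym Ouv) (proj₁ (proj₂ O∈Sr) v)) (λ ())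
        ⊆ (suc u) zero    Ouv = top-above adj simple {w = suc u} (proj₁ valid) (proj₂ valid) refl
        ⊆ (suc u) (suc v) Ouv = cong₂ _∧_ (proj₁ (proj₁ O∈Sr) (suc u) (suc v) Ouv)
          (trans (relabel-base σ u v) (proj₂ (proj₁ (isLinExt-char (restrictV O) (σ ∘ base)) ext) u v Ouv))

    -- Composition with the permutation `base` is a bijection on functions, so counting those σ for
    -- which σ ∘ base is a linear extension counts the linear extensions. No such σ is lost by the
    -- restriction to `perms`: as `base` is surjective, injectivity of σ ∘ base passes to σ.
    count-relabelings : countTrue (λ σ → sameOrient O (orientOf adj (relabel σ ∘ f))) (perms n) ≡ e (restrictV O)
    count-relabelings = trans (countTrue-cong (All.map sameOrient-isLinExt (perms-injective n)))
      (trans (countTrue-filter isPerm (allFuns n n))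
        (count-precompose (isLinExt (restrictV O)) (isLinExt-ext (restrictV O)) base-injective))
      where
      isPerm : ∀ σ → isLinExt (restrictV O) (σ ∘ base) ≡ true → isLinExt (λ _ _ → false) σ ≡ true
      isPerm σ ext = proj₂ (isLinExt-char (λ _ _ → false) σ) (σ-inj , λ _ _ ())
        where
        σ-inj : Injective _≡_ _≡_ σ
        σ-inj {x} {y} eq with injective⇒surjective base-injective x | injective⇒surjective base-injective y
        ... | x′ , refl | y′ , refl = cong base (proj₁ (proj₁ (isLinExt-char (restrictV O) (σ ∘ base)) ext) eq)

  module _ (E : Orient (suc n) → Bool) (detect : ∀ v f → Valid v f → E (orientOf adj f) ≡ (v ==ᶠ 𝐫)) where

    -- At time 0 both sides vanish unless n+1 is at 𝐫, where `count-relabelings` applies. The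
    -- induction step exchanges the sum over σ with the mean over neighbours, which uses that all
    -- relabelings share the same moving vertex.
    P-symmetry : ∀ t v f → Valid v f →
      sumℚ (map (λ σ → P adj (sameOrient O) t v (relabel σ ∘ f)) (perms n)) ≡ ι (e (restrictV O)) * P adj E t v f
    P-symmetry zero zero f valid = trans (sumℚ-indicator _ (perms n)) (trans (cong ι (count-relabelings valid))
      (trans (sym (ℚ.*-identityʳ _)) (cong (λ b → ι (e (restrictV O)) * indicator b) (sym (detect zero f valid)))))
    P-symmetry zero (suc u) f valid = trans (sumℚ-map-cong (All.map none (perms-injective n)))
      (trans (sumℚ-map-0 (perms n))
      (trans (sym (ℚ.*-zeroʳ (ι (e (restrictV O)))))
        (cong (λ b → ι (e (restrictV O)) * indicator b) (sym (detect (suc u) f valid)))))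
      where
      none : ∀ {σ} → Injective _≡_ _≡_ σ → P adj (sameOrient O) 0 (suc u) (relabel σ ∘ f) ≡ 0ℚ
      none {σ} σ-inj = cong indicator {sameOrient O (orientOf adj (relabel σ ∘ f))} (≢true⇒≡false (λ same →
        orientOf-∉Sr adj simple
        (proj₁ valid ∘ relabel-injective σ-inj , trans (cong (relabel σ) (proj₂ valid)) (relabel-fromℕ σ))
        (λ v → trans (sym (sameOrient⁻ O (orientOf adj (relabel σ ∘ f)) same 𝐫 v)) (proj₁ (proj₂ O∈Sr) v))))
    P-symmetry (suc t) v f valid = trans
      (average-sum (λ σ w → P adj (sameOrient O) t w (swapAt (relabel σ ∘ f) v w))
        (perms n) (neighbours (adjR adj) v))
      (trans (average-map-cong {xs = neighbours (adjR adj) v} (All.tabulate (λ {w} _ → trans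
        (sumℚ-map-cong {xs = perms n} (All.tabulate (λ {σ} _ →
          P-cong adj (sameOrient O) (sameOrient-ext O) t w (commute σ w))))
        (P-symmetry t w (swapAt f v w) (Valid-step valid w)))))
      (average-map-* (ι (e (restrictV O))) _ (neighbours (adjR adj) v)))
      where
      -- A relabeling acts on values and a slide on positions, so one is post- and the other
      -- precomposition.
      commute : ∀ σ w → swapAt (relabel σ ∘ f) v w ≗ relabel σ ∘ swapAt f v w
      commute σ w x = trans (swapAt-transpose (relabel σ ∘ f) v w x)
        (cong (relabel σ) (sym (swapAt-transpose f v w x)))

    S-symmetry : ∀ N v f → Valid v f →
      sumℚ (map (λ σ → S adj (sameOrient O) N v (relabel σ ∘ f)) (perms n)) ≡ ι (e (restrictV O)) * S adj E N v f
    S-symmetry zero    v f valid = trans (sumℚ-map-0 (perms n)) (sym (ℚ.*-zeroʳ (ι (e (restrictV O)))))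
    S-symmetry (suc N) v f valid = trans (sumℚ-map-+ _ _ (perms n))
      (trans (cong₂ _+_ (S-symmetry N v f valid) (P-symmetry (suc N) v f valid))
        (sym (ℚ.*-distribˡ-+ (ι (e (restrictV O))) (S adj E N v f) (P adj E (suc N) v f))))

-- From a bounded difference to the limit

-- Division of the bound by y gives |x/y - c| ≤ K/y, which is below ε once y exceeds K/ε. Such a y
-- is positive, so the default value of `÷ₜ` does not occur.
÷ₜ-close : ∀ {x y c K ε} (0<ε : 0ℚ < ε) → 0ℚ ℚ.≤ K → ∣ x - c * y ∣ ℚ.≤ K →
  K * ℚ.1/_ ε {{ℚ.>-nonZero 0<ε}} < y → ∣ (x ÷ₜ y) - c ∣ < ε
÷ₜ-close {x} {y} {c} {K} {ε} 0<ε 0≤K close K/ε<y = go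
  where
  instance
    ε-pos : ℚ.Positive ε
    ε-pos = ℚ.positive 0<ε
  1/ε : ℚ
  1/ε = ℚ.1/_ ε {{ℚ.>-nonZero 0<ε}}
  0<y : 0ℚ < y
  0<y = ℚ.≤-<-trans (0≤* 0≤K (ℚ.<⇒≤ (ℚ.positive⁻¹ 1/ε {{ℚ.1/pos⇒pos ε}}))) K/ε<y
  K<εy : K < ε * y
  K<εy = subst (_< ε * y)
    (trans (solve 3 (λ a b c → a :* (b :* c) := b :* (a :* c)) refl ε K 1/ε)
      (trans (cong (K *_) (ℚ.*-inverseʳ ε {{ℚ.>-nonZero 0<ε}})) (ℚ.*-identityʳ K)))
    (ℚ.*-monoʳ-<-pos ε K/ε<y)
  go : ∣ (x ÷ₜ y) - c ∣ < ε
  go with y ℚ.≟ 0ℚ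
  ... | yes y≡0 = contradiction (sym y≡0) (ℚ.<⇒≢ 0<y)
  ... | no  y≢0 = begin-strict
    ∣ x * 1/y - c ∣           ≡⟨ cong ∣_∣ factor ⟩
    ∣ (x - c * y) * 1/y ∣     ≡⟨ ℚ.∣p*q∣≡∣p∣*∣q∣ (x - c * y) 1/y ⟩
    ∣ x - c * y ∣ * ∣ 1/y ∣   ≡⟨ cong (∣ x - c * y ∣ *_) (ℚ.0≤p⇒∣p∣≡p (ℚ.<⇒≤ (ℚ.positive⁻¹ 1/y {{1/y-pos}}))) ⟩
    ∣ x - c * y ∣ * 1/y       ≤⟨ ℚ.*-monoʳ-≤-nonNeg 1/y {{ℚ.pos⇒nonNeg 1/y {{1/y-pos}}}} close ⟩
    K * 1/y                   <⟨ ℚ.*-monoˡ-<-pos 1/y {{1/y-pos}} K<εy ⟩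
    ε * y * 1/y               ≡⟨ trans (ℚ.*-assoc ε y 1/y) (trans (cong (ε *_) y*1/y) (ℚ.*-identityʳ ε)) ⟩
    ε                         ∎
    where
    open ℚ.≤-Reasoning
    1/y : ℚ
    1/y = ℚ.1/_ y {{ℚ.≢-nonZero y≢0}}
    1/y-pos : ℚ.Positive 1/y
    1/y-pos = ℚ.1/pos⇒pos y {{ℚ.positive 0<y}}
    y*1/y : y * 1/y ≡ 1ℚ
    y*1/y = ℚ.*-inverseʳ y {{ℚ.≢-nonZero y≢0}}
    factor : x * 1/y - c ≡ (x - c * y) * 1/y
    factor = trans (cong (λ z → x * 1/y - z) (sym (trans (cong (c *_) y*1/y) (ℚ.*-identityʳ c))))
      (solve 4 (λ x y c i → x :* i :- c :* (y :* i) := (x :- c :* y) :* i) refl x y c 1/y)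

theorem5p8 : (n : ℕ) → 1 ≤ n → (adj : Adj n) → IsSimple adj → Connected adj →
    (decS : (o : Orient (suc n)) → Dec (InSr adj o)) →
    (f₀ : Labeling n) → Injective _≡_ _≡_ f₀ →
    (v₀ : Fin (suc n)) → f₀ v₀ ≡ fromℕ n →
    ((B : ℚ) → ∃[ N ] (B < PartialSum adj N v₀ f₀ (λ o → isYes (decS o)))) ×
    ((O : Orient (suc n)) → InSr adj O →
    (ε : ℚ) → 0ℚ < ε → ∃[ N₀ ] ((N : ℕ) → N₀ ≤ N →
    ∣ (PartialSum adj N v₀ f₀ (sameOrient O)
    ÷ₜ PartialSum adj N v₀ f₀ (λ o → isYes (decS o)))
    - (_/_ (+ e (restrictV O)) (n !) {{n !≢0}}) ∣ < ε))
theorem5p8 n 1≤n adj simple conn decS f₀ f₀-inj v₀ f₀v₀ = unbounded , limit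
  where
  Sr : Orient (suc n) → Bool
  Sr o = isYes (decS o)
  valid₀ : Valid v₀ f₀
  valid₀ = f₀-inj , f₀v₀
  detect : ∀ v f → Valid v f → Sr (orientOf adj f) ≡ (v ==ᶠ 𝐫)
  detect = decS-detects adj simple decS
  unbounded : ∀ B → ∃[ N ] B < S adj Sr N v₀ f₀
  unbounded = S-unbounded adj Sr detect 1≤n (+ 1 / suc n)
    (ℚ.positive⁻¹ (+ 1 / suc n) {{ℚ.normalize-pos 1 (suc n)}}) (ι-*-/ 1 (suc n)) v₀ f₀ valid₀
  D : ℕ
  D = proj₁ (Reach-all adj simple conn)
  K : ℚ
  K = gap (suc n) D
  limit : ∀ O → InSr adj O → ∀ ε → 0ℚ < ε → ∃[ N₀ ] ∀ N → N₀ ≤ N →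
    ∣ (S adj (sameOrient O) N v₀ f₀ ÷ₜ S adj Sr N v₀ f₀) - (_/_ (+ e (restrictV O)) (n !) {{n !≢0}}) ∣ < ε
  limit O O∈Sr ε 0<ε = N₀ , λ N N₀≤N → ÷ₜ-close {c = c} 0<ε (gap-nonNeg (suc n) D) (close N)
    (ℚ.<-≤-trans (proj₂ (unbounded (K * 1/ε))) (S-mono adj Sr N₀≤N v₀ f₀))
    where
    c 1/ε : ℚ
    c = _/_ (+ e (restrictV O)) (n !) {{n !≢0}}
    1/ε = ℚ.1/_ ε {{ℚ.>-nonZero 0<ε}}
    N₀ : ℕ
    N₀ = proj₁ (unbounded (K * 1/ε))
    -- The target is now any labeling g with n+1 at v₀. As D is uniform in the target, the same K
    -- bounds the difference in both directions.
    oscillation : ∀ N f g → Valid v₀ f → Valid v₀ g →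
      S adj (sameOrient O) N v₀ f ℚ.≤ S adj (sameOrient O) N v₀ g + K
    oscillation N f g f-valid g-valid =
      S-oscillation adj (sameOrient O) (sameOrient-ext O) D v₀ g
        (λ v h h-valid → proj₂ (Reach-all adj simple conn) v h v₀ g (proj₁ h-valid) (proj₁ g-valid)
          (trans (proj₂ h-valid) (sym (proj₂ g-valid)))) N v₀ f f-valid
    close : ∀ N → ∣ S adj (sameOrient O) N v₀ f₀ - c * S adj Sr N v₀ f₀ ∣ ℚ.≤ K
    close N = ∣∣-≤
      (subst₂ ℚ._≤_ (solve 3 (λ x y k → x :- k :+ (k :- y) := x :- y) refl x y K)
        (solve 2 (λ y k → y :+ (k :- y) := k) refl y K) (ℚ.+-monoˡ-≤ (K - y) (cancel lower)))
      (subst₂ ℚ._≤_ (solve 2 (λ x y → y :- x := :- (x :- y)) refl x y)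
        (solve 2 (λ x k → x :+ k :- x := k) refl x K) (ℚ.+-monoˡ-≤ (- x) (cancel upper)))
      where
      x y : ℚ
      x = S adj (sameOrient O) N v₀ f₀
      y = c * S adj Sr N v₀ f₀
      F : (Fin n → Fin n) → ℚ
      F σ = S adj (sameOrient O) N v₀ (relabel σ ∘ f₀)
      relabel-valid : ∀ σ → Injective _≡_ _≡_ σ → Valid v₀ (relabel σ ∘ f₀)
      relabel-valid σ σ-inj = f₀-inj ∘ relabel-injective σ-inj , trans (cong (relabel σ) f₀v₀) (relabel-fromℕ σ)
      -- With c = e(O|_V)/n!, the symmetry says that y is the mean of F over the n! relabelings.
      -- Each F σ is within K of x, hence so is y.
      total : sumℚ (map F (perms n)) ≡ ι (n !) * y
      total = trans (S-symmetry adj simple O O∈Sr Sr detect N v₀ f₀ valid₀)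
        (trans (cong (_* S adj Sr N v₀ f₀) (sym (ι-*-/ (e (restrictV O)) (n !) {{n !≢0}})))
          (ℚ.*-assoc (ι (n !)) c (S adj Sr N v₀ f₀)))
      lower : ι (n !) * (x - K) ℚ.≤ ι (n !) * y
      lower = subst₂ ℚ._≤_ (cong (λ l → ι l * (x - K)) (length-perms n)) total
        (sumℚ-lower F (All.map {P = Injective _≡_ _≡_} (λ {σ} σ-inj → subst (x - K ℚ.≤_)
          (solve 2 (λ f k → f :+ k :- k := f) refl (F σ) K)
          (ℚ.+-monoˡ-≤ (- K) (oscillation N f₀ (relabel σ ∘ f₀) valid₀ (relabel-valid σ σ-inj)))) (perms-injective n)))
      upper : ι (n !) * y ℚ.≤ ι (n !) * (x + K)
      upper = subst₂ ℚ._≤_ total (cong (λ l → ι l * (x + K)) (length-perms n))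
        (sumℚ-upper F (All.map {P = Injective _≡_ _≡_} (λ {σ} σ-inj →
          oscillation N (relabel σ ∘ f₀) f₀ (relabel-valid σ σ-inj) valid₀) (perms-injective n)))
      cancel : ∀ {p q} → ι (n !) * p ℚ.≤ ι (n !) * q → p ℚ.≤ q
      cancel = ℚ.*-cancelˡ-≤-pos (ι (n !)) {{ℚ.normalize-pos (n !) 1 {{_}} {{n !≢0}}}}
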